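{- Let $G$ be a graph that is both minimally $3$-connected and critically $3$-connected, and let $v_3(G)$ denote the number of vertices of degree three in $G$. Then $v_3(G)\ge \frac{|V(G)|+3}{2}$.
   Context: All graphs are finite and simple. A graph is $3$-connected if it has more than $3$ vertices and no vertex cut of size less than $3$. A graph $G$ is minimally $3$-connected if $G$ is $3$-connected but $G\setminus e$ is not $3$-connected for every edge $e$; it is critically $3$-connected if $G$ is $3$-connected but $G-v$ is not $3$-connected for every vertex $v$. -}

module Defs where

open import Data.Nat using (ℕ; _<_; _≡ᵇ_)
open import Data.Bool using (Bool; true; false; _∧_; _∨_; not)
open import Data.Fin using (Fin; _≟_)
open import Data.Fin.Subset using (Subset; _∈_; _⊆_; _─_; _-_; ⊤; ∣_∣)
open import Data.Vec using (tabulate)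
open import Data.Product using (_×_)
open import Relation.Nullary using (¬_)
open import Relation.Nullary.Decidable using (⌊_⌋)
open import Relation.Binary.PropositionalEquality using (_≡_)

Adjacency : ℕ → Set
Adjacency n = Fin n → Fin n → Bool

record Graph (n : ℕ) : Set where
  field
    adj   : Adjacency n
    sym   : ∀ u v → adj u v ≡ adj v u
    irrefl : ∀ v → adj v v ≡ false
open Graph public

data Reach {n : ℕ} (A : Adjacency n) (W : Subset n) : Fin n → Fin n → Set where
  here : ∀ {u} → u ∈ W → Reach A W u u
  step : ∀ {u w v} → u ∈ W → A u w ≡ true → Reach A W w v → Reach A W u v

ConnectedOn : ∀ {n} → Adjacency n → Subset n → Set
ConnectedOn A W = ∀ u v → u ∈ W → v ∈ W → Reach A W u v

KConnectedOn : ∀ {n} → ℕ → Adjacency n → Subset n → Set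
KConnectedOn {n} k A W =
  k < ∣ W ∣ × (∀ (S : Subset n) → S ⊆ W → ∣ S ∣ < k → ConnectedOn A (W ─ S))

ThreeConnected : ∀ {n} → Graph n → Set
ThreeConnected G = KConnectedOn 3 (adj G) ⊤

deleteEdge : ∀ {n} → Adjacency n → Fin n → Fin n → Adjacency n
deleteEdge A a b x y =
  A x y ∧ not ((⌊ x ≟ a ⌋ ∧ ⌊ y ≟ b ⌋) ∨ (⌊ x ≟ b ⌋ ∧ ⌊ y ≟ a ⌋))

MinimallyThreeConnected : ∀ {n} → Graph n → Set
MinimallyThreeConnected G =
  ThreeConnected G ×
  (∀ a b → adj G a b ≡ true → ¬ KConnectedOn 3 (deleteEdge (adj G) a b) ⊤)

CriticallyThreeConnected : ∀ {n} → Graph n → Set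
CriticallyThreeConnected G =
  ThreeConnected G × (∀ v → ¬ KConnectedOn 3 (adj G) (⊤ - v))

degree : ∀ {n} → Graph n → Fin n → ℕ
degree G v = ∣ tabulate (adj G v) ∣

v₃ : ∀ {n} → Graph n → ℕ
v₃ G = ∣ tabulate (λ v → degree G v ≡ᵇ 3) ∣

{-# OPTIONS --safe #-}
module Submission where

-- Let V₃ be the set of vertices of degree 3 and F the rest. For a set M of vertices put
-- ψ(M) = 2 e(M) − |M ∩ V₃| − Σ_{v ∈ M ∩ F} (deg v + 2). Then ψ(V) = 2 |V₃| − 2 |F|, and
-- ψ(V) = ψ(V − v₀) + 5 for every v₀ ∈ V₃, so (as ψ(V) is even) it suffices that ψ(V − v₀) ≥ 0.
-- Absorb vertices into M, starting from the empty set, as long as ψ does not decrease. If this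
-- gets stuck, the vertices of F left over have at least two neighbours that are left over or v₀,
-- and those of V₃ left over are independent and have no neighbour in M.
-- By minimality an edge joining two vertices of F, and by criticality some edge at a vertex of V₃
-- with all neighbours in F, is the only edge between the two large sides of a separation with two
-- further vertices. Among the separations of leftover edges that keep v₀ on the upper side choose
-- one whose lower side is smallest. Uncrossing shows that no other such edge meets the lower side,
-- and then absorbing two vertices of F from it together with at most three vertices of V₃ would
-- not have decreased ψ.

open import Defs
open import Data.Bool using (Bool; true; false; T)
import Data.Bool as Bool
open import Data.Nat using (ℕ; zero; suc; _+_; _*_; _≤_; _<_; z≤n; s≤s; _≤?_; _≡ᵇ_)
import Data.Nat as ℕ
open import Data.Nat.Properties hiding (_≟_)
open import Data.Nat.Solver using (module +-*-Solver)
open +-*-Solver using (solve; _:=_; _:+_; _:*_; con)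
open import Data.Fin using (Fin; zero; suc; _≟_; fromℕ<)
open import Data.Fin.Properties using (any?)
open import Data.Fin.Subset using (Subset; _─_; _-_; ⊤; ∣_∣; _⊆_; inside; outside)
  renaming (_∈_ to _∈ˢ_; _∉_ to _∉ˢ_)
open import Data.Fin.Subset.Properties
  using (_∈?_; ∈⊤; ⊆⊤; x∈p∧x∉q⇒x∈p─q; x∈p∧x≢y⇒x∈p-y; x∈⁅x⁆; ∣⊤∣≡n)
open import Data.Vec using (tabulate; lookup; _∷_; here; there)
open import Data.Vec.Properties using (lookup∘tabulate; tabulate∘lookup; []=⇒lookup; lookup⇒[]=)
open import Data.List using (List; []; _∷_; length)
open import Data.List.Membership.Propositional using (_∈_)
open import Data.List.Relation.Unary.Any using (here; there)
open import Data.List.Relation.Unary.All using (All; []; _∷_)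
open import Data.List.Relation.Unary.AllPairs using ([]; _∷_)
open import Data.List.Relation.Unary.Unique.Propositional using (Unique)
open import Data.Product using (∃; _×_; _,_; proj₁; proj₂)
open import Data.Sum using (_⊎_; inj₁; inj₂; map₂)
open import Data.Empty using (⊥; ⊥-elim)
open import Function using (_∘_; case_of_)
open import Relation.Nullary using (¬_; Dec; yes; no; does; ¬?; _×-dec_)
open import Relation.Nullary.Decidable using (False; toWitnessFalse)
open import Relation.Binary.PropositionalEquality
  using (_≡_; _≢_; refl; cong; cong₂; subst; trans; module ≡-Reasoning)
import Relation.Binary.PropositionalEquality as ≡
open import Algebra.Properties.CommutativeMonoid.Sum +-0-commutativeMonoid
  using (sum; ∑-distrib-+; ∑-comm; sum-cong-≗)

-- Sums and cardinalities

-- The cost of a vertex of F is balanced so that degree at least four allows absorption once all but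
-- one of its neighbours are in M. The 5 arises because `v₀` costs 1 while its at least three edges
-- count twice. Its edges bring nothing to the vertices absorbed around it, which is why it is kept
-- off the lower side. Should it lie in the separator, it can be exchanged with a neighbour, since
-- one of the two sides contains at most one neighbour of it. That some `v₀` exists needs its own
-- uncrossing argument: if all degrees were at least four, every edge would carry a separation. The
-- delicate separations are those with a side so small that nothing remains when an end of the edge
-- joins the separator. `Sturdy` is the degree condition that rules them out. The descent leaves no
-- separation of leftover edges, so every leftover vertex of degree three is a neighbour of `v₀`.
-- There are then at most three of them, and the two neighbours in F of one of them can be absorbed
-- together with all of them, unless both are also neighbours of `v₀`; then these two would be a cut
-- or the graph would have too few vertices.

impossible : ∀ {m k} {_ : False (m ≤? k)} → ¬ m ≤ k
impossible {_} {_} {m≰k} = toWitnessFalse m≰k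

⟦_⟧ : Bool → ℕ
⟦ true ⟧  = 1
⟦ false ⟧ = 0

δ : ∀ {n} → Fin n → Fin n → ℕ
δ a v = ⟦ does (a ≟ v) ⟧

δ-refl : ∀ {n} (a : Fin n) → δ a a ≡ 1
δ-refl a with a ≟ a
... | yes _   = refl
... | no a≢a = ⊥-elim (a≢a refl)

δ-≢ : ∀ {n} {a v : Fin n} → a ≢ v → δ a v ≡ 0
δ-≢ {a = a} {v} a≢v with a ≟ v
... | yes a≡v = ⊥-elim (a≢v a≡v)
... | no _    = refl

sum-mono : ∀ {n} {f g : Fin n → ℕ} → (∀ v → f v ≤ g v) → sum f ≤ sum g
sum-mono {zero}  f≤g = z≤n
sum-mono {suc n} f≤g = +-mono-≤ (f≤g zero) (sum-mono (f≤g ∘ suc))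

sum-zero : ∀ {n} {f : Fin n → ℕ} → (∀ v → f v ≡ 0) → sum f ≡ 0
sum-zero {zero}  f≡0 = refl
sum-zero {suc n} f≡0 = cong₂ _+_ (f≡0 zero) (sum-zero (f≡0 ∘ suc))

sum-pick : ∀ {n} (a : Fin n) (g : Fin n → ℕ) → sum (λ v → δ a v * g v) ≡ g a
sum-pick {suc n} zero g = trans (cong₂ _+_ (+-identityʳ (g zero)) (sum-zero {n} {λ _ → 0} λ _ → refl))
                                (+-identityʳ (g zero))
sum-pick (suc a) g = sum-pick a (g ∘ suc)

sum-δ : ∀ {n} (a : Fin n) → sum (δ a) ≡ 1
sum-δ a = trans (sum-cong-≗ λ v → ≡.sym (*-identityʳ (δ a v))) (sum-pick a λ _ → 1)

sum-one : ∀ n → sum {n} (λ _ → 1) ≡ n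
sum-one zero    = refl
sum-one (suc n) = cong suc (sum-one n)

sum-*ˡ : ∀ {n} c (f : Fin n → ℕ) → sum (λ v → c * f v) ≡ c * sum f
sum-*ˡ {zero}  c f = ≡.sym (*-zeroʳ c)
sum-*ˡ {suc n} c f = trans (cong (c * f zero +_) (sum-*ˡ c (f ∘ suc)))
                           (≡.sym (*-distribˡ-+ c (f zero) (sum (f ∘ suc))))

∣tabulate∣ : ∀ {n} (f : Fin n → Bool) → ∣ tabulate f ∣ ≡ sum (⟦_⟧ ∘ f)
∣tabulate∣ {zero}  f = refl
∣tabulate∣ {suc n} f with f zero
... | true  = cong suc (∣tabulate∣ (f ∘ suc))
... | false = ∣tabulate∣ (f ∘ suc)

indicator : ∀ {n} → List (Fin n) → Fin n → ℕ
indicator []       v = 0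
indicator (x ∷ xs) v = δ x v + indicator xs v

sum-indicator : ∀ {n} (xs : List (Fin n)) → sum (indicator xs) ≡ length xs
sum-indicator {n} [] = sum-zero {n} {λ _ → 0} λ _ → refl
sum-indicator (x ∷ xs) = trans (∑-distrib-+ (δ x) (indicator xs))
                               (cong₂ _+_ (sum-δ x) (sum-indicator xs))

∈⇒indicator : ∀ {n} {xs : List (Fin n)} {v} → v ∈ xs → 1 ≤ indicator xs v
∈⇒indicator {xs = x ∷ xs} {v} (here refl)  = ≤-trans (≤-reflexive (≡.sym (δ-refl v))) (m≤m+n _ _)
∈⇒indicator {xs = x ∷ xs} {v} (there v∈xs) = ≤-trans (∈⇒indicator v∈xs) (m≤n+m _ (δ x v))

∉⇒indicator : ∀ {n} {xs : List (Fin n)} {v} → All (v ≢_) xs → indicator xs v ≡ 0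
∉⇒indicator []              = refl
∉⇒indicator (v≢x ∷ v≢xs) = cong₂ _+_ (δ-≢ (v≢x ∘ ≡.sym)) (∉⇒indicator v≢xs)

-- For distinct entries the indicator of the list is at most `f` at every point. Lower bounds on
-- degrees, separators and lower sides are all obtained in this way.
unique≤sum : ∀ {n} {xs : List (Fin n)} (f : Fin n → ℕ) → Unique xs → All (λ x → 1 ≤ f x) xs →
             length xs ≤ sum f
unique≤sum {xs = xs} f xs! 1≤f = ≤-trans (≤-reflexive (≡.sym (sum-indicator xs))) (sum-mono (go xs! 1≤f))
  where
  go : ∀ {xs} → Unique xs → All (λ x → 1 ≤ f x) xs → ∀ v → indicator xs v ≤ f v
  go []                        []           v = z≤n
  go {x ∷ xs} (x≢xs ∷ xs!) (1≤fx ∷ 1≤f) v with x ≟ v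
  ... | yes refl = subst (λ k → suc k ≤ f x) (≡.sym (∉⇒indicator x≢xs)) 1≤fx
  ... | no _     = go xs! 1≤f v

-- Separations: lower side, separator, upper side

data Side : Set where
  lo mid hi : Side

isMid isLo : Side → ℕ
isMid lo  = 0
isMid mid = 1
isMid hi  = 0
isLo lo  = 1
isLo mid = 0
isLo hi  = 0

flip : Side → Side
flip lo  = hi
flip mid = mid
flip hi  = lo

infixl 6 _⊔_

-- The maximum for `lo` < `mid` < `hi`. On separations it intersects the lower sides and unites the
-- upper sides.
_⊔_ : Side → Side → Side
lo  ⊔ t  = t
mid ⊔ lo = mid
mid ⊔ t  = t
hi  ⊔ t  = hi

_≟ˢ_ : (s t : Side) → Dec (s ≡ t)
lo  ≟ˢ lo  = yes refl
lo  ≟ˢ mid = no λ ()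
lo  ≟ˢ hi  = no λ ()
mid ≟ˢ lo  = no λ ()
mid ≟ˢ mid = yes refl
mid ≟ˢ hi  = no λ ()
hi  ≟ˢ lo  = no λ ()
hi  ≟ˢ mid = no λ ()
hi  ≟ˢ hi  = yes refl

flip-lo : ∀ {s} → flip s ≡ lo → s ≡ hi
flip-lo {hi} _ = refl

flip-hi : ∀ {s} → flip s ≡ hi → s ≡ lo
flip-hi {lo} _ = refl

flip-mid : ∀ {s} → flip s ≡ mid → s ≡ mid
flip-mid {mid} _ = refl

⊔-lo : ∀ {s t} → s ⊔ t ≡ lo → s ≡ lo × t ≡ lo
⊔-lo {lo} {lo}  _ = refl , refl
⊔-lo {mid} {lo} ()
⊔-lo {mid} {mid} ()
⊔-lo {mid} {hi} ()

⊔-hi : ∀ {s t} → s ⊔ t ≡ hi → s ≡ hi ⊎ t ≡ hi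
⊔-hi {lo}  {hi}  _ = inj₂ refl
⊔-hi {mid} {hi}  _ = inj₂ refl
⊔-hi {hi}  {_}   _ = inj₁ refl
⊔-hi {mid} {lo} ()
⊔-hi {mid} {mid} ()

isMid-flip : ∀ s → isMid (flip s) ≡ isMid s
isMid-flip lo  = refl
isMid-flip mid = refl
isMid-flip hi  = refl

-- `flip s ⊔ flip t` is the flipped minimum of `s` and `t`, and the maximum and minimum of two sides
-- are the same two sides. Summed over the vertices, this trades the separator of one corner against
-- that of the opposite corner.
isMid-modular : ∀ s t → isMid (s ⊔ t) + isMid (flip s ⊔ flip t) ≡ isMid s + isMid t
isMid-modular lo  lo  = refl
isMid-modular lo  mid = refl
isMid-modular lo  hi  = refl
isMid-modular mid lo  = refl
isMid-modular mid mid = refl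
isMid-modular mid hi  = refl
isMid-modular hi  lo  = refl
isMid-modular hi  mid = refl
isMid-modular hi  hi  = refl

Sides : ℕ → Set
Sides n = Fin n → Side

#mid #lo : ∀ {n} → Sides n → ℕ
#mid ρ = sum (isMid ∘ ρ)
#lo  ρ = sum (isLo ∘ ρ)

infixl 6 _⊔̇_

_⊔̇_ : ∀ {n} → Sides n → Sides n → Sides n
(ρ ⊔̇ τ) v = ρ v ⊔ τ v

infix 7 _ᵒ

_ᵒ : ∀ {n} → Sides n → Sides n
(ρ ᵒ) v = flip (ρ v)

#mid-modular : ∀ {n} (ρ τ : Sides n) → #mid (ρ ⊔̇ τ) + #mid (ρ ᵒ ⊔̇ τ ᵒ) ≡ #mid ρ + #mid τ
#mid-modular ρ τ = trans (≡.sym (∑-distrib-+ (isMid ∘ (ρ ⊔̇ τ)) (isMid ∘ (ρ ᵒ ⊔̇ τ ᵒ))))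
  (trans (sum-cong-≗ λ v → isMid-modular (ρ v) (τ v)) (∑-distrib-+ (isMid ∘ ρ) (isMid ∘ τ)))

#mid-ᵒ : ∀ {n} (ρ : Sides n) → #mid (ρ ᵒ) ≡ #mid ρ
#mid-ᵒ ρ = sum-cong-≗ (isMid-flip ∘ ρ)

infixl 8 _[_]≔_

_[_]≔_ : ∀ {n} → Sides n → Fin n → Side → Sides n
(ρ [ a ]≔ s) v with a ≟ v
... | yes _ = s
... | no _  = ρ v

≔-same : ∀ {n} (ρ : Sides n) a s → (ρ [ a ]≔ s) a ≡ s
≔-same ρ a s with a ≟ a
... | yes _   = refl
... | no a≢a = ⊥-elim (a≢a refl)

≔-other : ∀ {n} (ρ : Sides n) {a v} s → a ≢ v → (ρ [ a ]≔ s) v ≡ ρ v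
≔-other ρ {a} {v} s a≢v with a ≟ v
... | yes a≡v = ⊥-elim (a≢v a≡v)
... | no _    = refl

≔-inv : ∀ {n} (ρ : Sides n) a s {v t} → (ρ [ a ]≔ s) v ≡ t → (a ≡ v × s ≡ t) ⊎ (a ≢ v × ρ v ≡ t)
≔-inv ρ a s {v} eq with a ≟ v
... | yes a≡v = inj₁ (a≡v , eq)
... | no a≢v  = inj₂ (a≢v , eq)

isMid≤1 : ∀ s → isMid s ≤ 1
isMid≤1 lo  = z≤n
isMid≤1 mid = s≤s z≤n
isMid≤1 hi  = z≤n

#mid-grow : ∀ {n} (ρ : Sides n) a s → #mid (ρ [ a ]≔ s) ≤ suc (#mid ρ)
#mid-grow ρ a s = ≤-trans (sum-mono pointwise)
  (≤-reflexive (trans (∑-distrib-+ (δ a) (isMid ∘ ρ)) (cong (_+ #mid ρ) (sum-δ a))))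
  where
  pointwise : ∀ v → isMid ((ρ [ a ]≔ s) v) ≤ δ a v + isMid (ρ v)
  pointwise v with a ≟ v
  ... | yes _ = ≤-trans (isMid≤1 s) (m≤m+n 1 _)
  ... | no _  = ≤-refl

#mid-shrink : ∀ {n} (ρ : Sides n) a s → ρ a ≡ mid → isMid s ≡ 0 → suc (#mid (ρ [ a ]≔ s)) ≤ #mid ρ
#mid-shrink ρ a s ρa s≢mid = ≤-trans
  (≤-reflexive (≡.sym (trans (∑-distrib-+ (δ a) (isMid ∘ (ρ [ a ]≔ s)))
                             (cong (_+ #mid (ρ [ a ]≔ s)) (sum-δ a)))))
  (sum-mono pointwise)
  where
  pointwise : ∀ v → δ a v + isMid ((ρ [ a ]≔ s) v) ≤ isMid (ρ v)
  pointwise v with a ≟ v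
  ... | yes refl rewrite s≢mid | ρa = ≤-refl
  ... | no _  = ≤-refl

mids≤ : ∀ {n} (ρ : Sides n) {xs} → Unique xs → All (λ x → ρ x ≡ mid) xs → length xs ≤ #mid ρ
mids≤ ρ xs! all = unique≤sum (isMid ∘ ρ) xs! (go all)
  where
  go : ∀ {xs} → All (λ x → ρ x ≡ mid) xs → All (λ x → 1 ≤ isMid (ρ x)) xs
  go []          = []
  go (eq ∷ eqs) = ≤-reflexive (cong isMid (≡.sym eq)) ∷ go eqs

#lo-strict : ∀ {n} {ρ τ : Sides n} (a : Fin n) → (∀ v → ρ v ≡ lo → τ v ≡ lo × v ≢ a) → τ a ≡ lo →
             #lo ρ < #lo τ
#lo-strict {ρ = ρ} {τ} a ρ⊆τ τa = ≤-trans
  (≤-reflexive (≡.sym (trans (∑-distrib-+ (δ a) (isLo ∘ ρ)) (cong (_+ #lo ρ) (sum-δ a)))))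
  (sum-mono pointwise)
  where
  pointwise : ∀ v → δ a v + isLo (ρ v) ≤ isLo (τ v)
  pointwise v with a ≟ v | ρ v ≟ˢ lo
  ... | yes refl | yes ρv = ⊥-elim (proj₂ (ρ⊆τ v ρv) refl)
  ... | no _     | yes ρv rewrite ρv | proj₁ (ρ⊆τ v ρv) = ≤-refl
  ... | yes refl | no ρv≢lo rewrite τa = lemma (ρ v) ρv≢lo
    where
    lemma : ∀ s → s ≢ lo → 1 + isLo s ≤ 1
    lemma lo  s≢ = ⊥-elim (s≢ refl)
    lemma mid _  = ≤-refl
    lemma hi  _  = ≤-refl
  ... | no _     | no ρv≢lo = lemma (ρ v) ρv≢lo
    where
    lemma : ∀ s → s ≢ lo → isLo s ≤ isLo (τ v)
    lemma lo  s≢ = ⊥-elim (s≢ refl)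
    lemma mid _  = z≤n
    lemma hi  _  = z≤n

#mid-keep : ∀ {n} (ρ : Sides n) a s → isMid s ≡ 0 → #mid (ρ [ a ]≔ s) ≤ #mid ρ
#mid-keep ρ a s s≢mid = sum-mono pointwise
  where
  pointwise : ∀ v → isMid ((ρ [ a ]≔ s) v) ≤ isMid (ρ v)
  pointwise v with a ≟ v
  ... | yes _ rewrite s≢mid = z≤n
  ... | no _  = ≤-refl

flip-flip : ∀ s → flip (flip s) ≡ s
flip-flip lo  = refl
flip-flip mid = refl
flip-flip hi  = refl

hi⊔ : ∀ {s} t → s ≡ hi → s ⊔ t ≡ hi
hi⊔ t refl = refl

⊔hi : ∀ s {t} → t ≡ hi → s ⊔ t ≡ hi
⊔hi lo  refl = refl
⊔hi mid refl = refl
⊔hi hi  refl = refl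

≡⊔ : ∀ {s t s′ t′} → s ≡ s′ → t ≡ t′ → s ⊔ t ≡ s′ ⊔ t′
≡⊔ = cong₂ _⊔_

clash : ∀ {s t} {A : Set} → s ≡ lo → s ≡ t → t ≢ lo → A
clash refl refl t≢lo = ⊥-elim (t≢lo refl)

lo≢mid : lo ≢ mid
lo≢mid ()

lo≢hi : lo ≢ hi
lo≢hi ()

mid≢hi : mid ≢ hi
mid≢hi ()

rest≤ : ∀ {a b} k {j} → a + b ≤ k + j → k ≤ b → a ≤ j
rest≤ {a} {b} k {j} a+b≤ k≤b = +-cancelˡ-≤ k a j (≤-trans (+-monoˡ-≤ a k≤b) (≤-trans (≤-reflexive (+-comm b a)) a+b≤))

rest≤′ : ∀ {a b} k {j} → a + b ≤ k + j → k ≤ a → b ≤ j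
rest≤′ {a} {b} k a+b≤ k≤a = rest≤ k (≤-trans (≤-reflexive (+-comm b a)) a+b≤) k≤a

-- Separations of a graph by two vertices and one crossing edge

module Separations {n : ℕ} (G : Graph n) where

  infix 4 _~_ _~?_

  _~_ : Fin n → Fin n → Set
  u ~ w = adj G u w ≡ true

  _~?_ : ∀ u w → Dec (u ~ w)
  u ~? w = adj G u w Bool.≟ true

  ~-sym : ∀ {u w} → u ~ w → w ~ u
  ~-sym {u} {w} u~w = trans (Graph.sym G w u) u~w

  ~⇒≢ : ∀ {u w} → u ~ w → u ≢ w
  ~⇒≢ {u} u~u refl with trans (≡.sym u~u) (irrefl G u)
  ... | ()

  deg : Fin n → ℕ
  deg v = sum (λ w → ⟦ adj G v w ⟧)

  deg≤ : ∀ (ρ : Sides n) xs {v} → (∀ {w} → v ~ w → ρ w ≡ mid ⊎ w ∈ xs) → deg v ≤ #mid ρ + length xs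
  deg≤ ρ xs {v} near = ≤-trans (sum-mono pointwise)
    (≤-reflexive (trans (∑-distrib-+ (isMid ∘ ρ) (indicator xs)) (cong (#mid ρ +_) (sum-indicator xs))))
    where
    pointwise : ∀ w → ⟦ adj G v w ⟧ ≤ isMid (ρ w) + indicator xs w
    pointwise w with adj G v w in eq
    ... | false = z≤n
    ... | true with near eq
    ...   | inj₁ ρw = ≤-trans (≤-reflexive (cong isMid (≡.sym ρw))) (m≤m+n _ _)
    ...   | inj₂ w∈xs = ≤-trans (∈⇒indicator w∈xs) (m≤n+m _ _)

  nbrs≤deg : ∀ {v xs} → Unique xs → All (v ~_) xs → length xs ≤ deg v
  nbrs≤deg {v} xs! all = unique≤sum (λ w → ⟦ adj G v w ⟧) xs! (go all)
    where
    go : ∀ {xs} → All (v ~_) xs → All (λ w → 1 ≤ ⟦ adj G v w ⟧) xs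
    go []            = []
    go (v~w ∷ v~ws) = ≤-reflexive (cong ⟦_⟧ (≡.sym v~w)) ∷ go v~ws

  Cross : Sides n → Fin n → Fin n → Set
  Cross ρ u w = u ~ w × ρ u ≡ lo × ρ w ≡ hi

  Uncrossed : Sides n → Set
  Uncrossed ρ = ∀ {u w} → ¬ Cross ρ u w

  Only : Sides n → Fin n → Fin n → Set
  Only ρ y x = ∀ {u w} → Cross ρ u w → u ≡ y × w ≡ x

  record Sep (ρ : Sides n) (y x : Fin n) : Set where
    constructor mkSep
    field
      y~x   : y ~ x
      y∈lo  : ρ y ≡ lo
      x∈hi  : ρ x ≡ hi
      only  : Only ρ y x
      small : #mid ρ ≤ 2

  -- The extra vertices exclude one-vertex sides: either end of the edge may join the separator and
  -- both sides stay inhabited.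
  record Good (ρ : Sides n) (y x : Fin n) : Set where
    constructor mkGood
    field
      sep  : Sep ρ y x
      more-lo : ∃ λ u → u ≢ y × ρ u ≡ lo
      more-hi : ∃ λ w → w ≢ x × ρ w ≡ hi
    open Sep sep public

  Cross-ᵒ : ∀ {ρ u w} → Cross (ρ ᵒ) u w → Cross ρ w u
  Cross-ᵒ (u~w , u∈ , w∈) = ~-sym u~w , flip-hi w∈ , flip-lo u∈

  Only-ᵒ : ∀ {ρ y x} → Only ρ y x → Only (ρ ᵒ) x y
  Only-ᵒ {ρ} only c with only (Cross-ᵒ {ρ} c)
  ... | eq₁ , eq₂ = eq₂ , eq₁

  Sep-ᵒ : ∀ {ρ y x} → Sep ρ y x → Sep (ρ ᵒ) x y
  Sep-ᵒ {ρ} (mkSep y~x y∈ x∈ only small) =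
    mkSep (~-sym y~x) (cong flip x∈) (cong flip y∈) (Only-ᵒ {ρ} only) (≤-trans (≤-reflexive (#mid-ᵒ ρ)) small)

  Good-ᵒ : ∀ {ρ y x} → Good ρ y x → Good (ρ ᵒ) x y
  Good-ᵒ (mkGood sep (u , u≢ , u∈) (w , w≢ , w∈)) =
    mkGood (Sep-ᵒ sep) (w , w≢ , cong flip w∈) (u , u≢ , cong flip u∈)

  Cross-⊔ : ∀ {ρ τ u w} → Cross (ρ ⊔̇ τ) u w → (Cross ρ u w × τ u ≡ lo) ⊎ (Cross τ u w × ρ u ≡ lo)
  Cross-⊔ (u~w , u∈ , w∈) with ⊔-lo u∈ | ⊔-hi w∈
  ... | ρu , τu | inj₁ ρw = inj₁ ((u~w , ρu , ρw) , τu)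
  ... | ρu , τu | inj₂ τw = inj₂ ((u~w , τu , τw) , ρu)

  Cross-≔mid : ∀ {ρ a u w} → Cross (ρ [ a ]≔ mid) u w → Cross ρ u w × a ≢ u × a ≢ w
  Cross-≔mid {ρ} {a} (u~w , u∈ , w∈) with ≔-inv ρ a mid u∈ | ≔-inv ρ a mid w∈
  ... | inj₂ (a≢u , ρu) | inj₂ (a≢w , ρw) = (u~w , ρu , ρw) , a≢u , a≢w
  ... | inj₁ (_ , ()) | _
  ... | inj₂ _ | inj₁ (_ , ())

  -- Holds for the vertices of degree at least four and for those without a neighbour of degree at
  -- most three, the two kinds of ends that minimality and criticality supply. It forbids that such
  -- an end and a neighbour of it both have degree at most three.
  Sturdy : Fin n → Set
  Sturdy v = ∀ {w} → v ~ w → deg w ≤ 3 → 4 ≤ deg v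

  ≡⊎≢ : ∀ (u v : Fin n) → u ≡ v ⊎ u ≢ v
  ≡⊎≢ u v with u ≟ v
  ... | yes eq = inj₁ eq
  ... | no ne  = inj₂ ne

  lo-other? : ∀ (ρ : Sides n) a → Dec (∃ λ u → u ≢ a × ρ u ≡ lo)
  lo-other? ρ a = any? (λ u → ¬? (u ≟ a) ×-dec (ρ u ≟ˢ lo))

  -- Two neighbours on each side would already be four.
  unique-side : ∀ {ρ : Sides n} {v} → deg v ≤ 3 →
                (∀ {u w} → v ~ u → v ~ w → ρ u ≡ hi → ρ w ≡ hi → u ≡ w) ⊎
                (∀ {u w} → v ~ u → v ~ w → ρ u ≡ lo → ρ w ≡ lo → u ≡ w)
  unique-side {ρ} {v} deg-v with any? (λ u → (v ~? u) ×-dec (ρ u ≟ˢ hi))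
  ... | no ¬u = inj₁ λ v~u _ u∈ _ → ⊥-elim (¬u (_ , v~u , u∈))
  ... | yes (u , v~u , u∈) with any? (λ u′ → (¬? (u′ ≟ u)) ×-dec ((v ~? u′) ×-dec (ρ u′ ≟ˢ hi)))
  ...   | no ¬u′ = inj₁ λ v~a v~b a∈ b∈ → trans (is-u v~a a∈) (≡.sym (is-u v~b b∈))
    where
    is-u : ∀ {a} → v ~ a → ρ a ≡ hi → a ≡ u
    is-u {a} v~a a∈ with a ≟ u
    ... | yes eq = eq
    ... | no a≢u = ⊥-elim (¬u′ (a , a≢u , v~a , a∈))
  ...   | yes (u′ , u′≢u , v~u′ , u′∈) = inj₂ unique
    where
    apart : ∀ {a b} → ρ a ≡ lo → ρ b ≡ hi → a ≢ b
    apart a∈ b∈ refl with trans (≡.sym a∈) b∈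
    ... | ()
    unique : ∀ {a b} → v ~ a → v ~ b → ρ a ≡ lo → ρ b ≡ lo → a ≡ b
    unique {a} {b} v~a v~b a∈ b∈ with a ≟ b
    ... | yes eq = eq
    ... | no a≢b = ⊥-elim (impossible (≤-trans
            (nbrs≤deg {v} {a ∷ b ∷ u ∷ u′ ∷ []}
              ((a≢b ∷ apart a∈ u∈ ∷ apart a∈ u′∈ ∷ []) ∷ (apart b∈ u∈ ∷ apart b∈ u′∈ ∷ []) ∷ ((u′≢u ∘ ≡.sym) ∷ []) ∷ [] ∷ [])
              (v~a ∷ v~b ∷ v~u ∷ v~u′ ∷ []))
            deg-v))

  -- Consequences of 3-connectivity for a single separation

  module Connected
    (connected : ∀ {ρ : Sides n} {l r} → Uncrossed ρ → ρ l ≡ lo → ρ r ≡ hi → #mid ρ ≤ 2 → ⊥)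
    (deg≥3 : ∀ v → 3 ≤ deg v)
    where

    uncrossed⇒3≤ : ∀ {ρ : Sides n} {l r} → Uncrossed ρ → ρ l ≡ lo → ρ r ≡ hi → 3 ≤ #mid ρ
    uncrossed⇒3≤ {ρ} un l∈ r∈ with 3 ≤? #mid ρ
    ... | yes p = p
    ... | no ¬p = ⊥-elim (connected un l∈ r∈ (≤-pred (≰⇒> ¬p)))

    -- Otherwise moving a to the middle leaves no crossing edge.
    only-lo : ∀ {ρ : Sides n} {a r} → (∀ {u w} → Cross ρ u w → u ≡ a) → ρ r ≡ hi → #mid ρ ≤ 1 →
              ∀ u → ρ u ≡ lo → u ≡ a
    only-lo {ρ} {a} {r} from r∈ small u u∈ with u ≟ a
    ... | yes eq = eq
    ... | no u≢a with a ≟ r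
    ...   | yes refl = ⊥-elim (connected {ρ} (λ c → bad c) u∈ r∈ (m≤n⇒m≤1+n small))
      where
      bad : Uncrossed ρ
      bad c with from c
      ... | refl with trans (≡.sym (proj₁ (proj₂ c))) r∈
      ...   | ()
    ...   | no a≢r = ⊥-elim (connected {ρ [ a ]≔ mid}
              (λ c → let c′ , a≢u , _ = Cross-≔mid {ρ} c in a≢u (≡.sym (from c′)))
              (trans (≔-other ρ mid (u≢a ∘ ≡.sym)) u∈)
              (trans (≔-other ρ mid a≢r) r∈)
              (≤-trans (#mid-grow ρ a mid) (s≤s small)))

    -- With at most one separating vertex, `only-lo` leaves `a` alone on the lower side, and then
    -- `a` has degree at most two.
    only⇒2≤ : ∀ {ρ : Sides n} {a b} → Only ρ a b → ρ a ≡ lo → ρ b ≡ hi → 2 ≤ #mid ρ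
    only⇒2≤ {ρ} {a} {b} only a∈ b∈ with 2 ≤? #mid ρ
    ... | yes p = p
    ... | no ¬p = ⊥-elim (impossible (≤-trans (deg≥3 a) (≤-trans (deg≤ ρ (b ∷ []) near) (+-monoˡ-≤ 1 small))))
      where
      small : #mid ρ ≤ 1
      small = ≤-pred (≰⇒> ¬p)
      near : ∀ {w} → a ~ w → ρ w ≡ mid ⊎ w ∈ b ∷ []
      near {w} a~w with ρ w in ρw
      ... | mid = inj₁ refl
      ... | hi  = inj₂ (here (proj₂ (only (a~w , a∈ , ρw))))
      ... | lo  = ⊥-elim (~⇒≢ a~w (≡.sym (only-lo {ρ} (proj₁ ∘ only) b∈ small w ρw)))

    -- The possible neighbours of `z` are `y` and at most two separating vertices, so `z` has degree
    -- three and is joined to all of them. Sturdiness then gives `y` degree at least four, while its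
    -- only possible neighbours are `x`, `z` and the same separating vertices.
    lo-pair : ∀ {ρ : Sides n} {y x z} → Good ρ y x → Sturdy y → z ≢ y → ρ z ≡ lo →
              (∀ {u} → ρ u ≡ lo → u ≡ y ⊎ u ≡ z) →
              4 ≤ deg y × (∀ {m} → ρ m ≡ mid → y ~ m × z ~ m)
    lo-pair {ρ} {y} {x} {z} good sturdy z≢y z∈ pair = 4≤deg , λ m∈ → adj-y m∈ , adj-z m∈
      where
      open Good good
      near-z : ∀ {w} → z ~ w → ρ w ≡ mid ⊎ w ∈ y ∷ []
      near-z {w} z~w with ρ w in ρw
      ... | mid = inj₁ refl
      ... | hi  = ⊥-elim (z≢y (proj₁ (only (z~w , z∈ , ρw))))
      ... | lo with pair ρw
      ...   | inj₁ w≡y = inj₂ (here w≡y)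
      ...   | inj₂ w≡z = ⊥-elim (~⇒≢ z~w (≡.sym w≡z))
      deg-z : deg z ≤ 3
      deg-z = ≤-trans (deg≤ ρ (y ∷ []) near-z) (+-monoˡ-≤ 1 small)
      y~z : y ~ z
      y~z with z ~? y
      ... | yes z~y = ~-sym z~y
      ... | no z≁y = ⊥-elim (impossible (≤-trans (deg≥3 z) (≤-trans (deg≤ ρ [] near) (+-monoˡ-≤ 0 small))))
        where
        near : ∀ {w} → z ~ w → ρ w ≡ mid ⊎ w ∈ []
        near z~w with near-z z~w
        ... | inj₁ ρw = inj₁ ρw
        ... | inj₂ (here refl) = ⊥-elim (z≁y z~w)
      4≤deg : 4 ≤ deg y
      4≤deg = sturdy y~z deg-z
      shrink : ∀ {m} → ρ m ≡ mid → #mid (ρ [ m ]≔ hi) ≤ 1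
      shrink {m} m∈ = ≤-pred (≤-trans (#mid-shrink ρ m hi m∈ refl) small)
      still-mid : ∀ {v m w} → v ~ w → ¬ (v ~ m) → ρ w ≡ mid → (ρ [ m ]≔ hi) w ≡ mid
      still-mid {m = m} v~w v≁m w∈ = trans (≔-other ρ {m} hi λ {refl → v≁m v~w}) w∈
      adj-z : ∀ {m} → ρ m ≡ mid → z ~ m
      adj-z {m} m∈ with z ~? m
      ... | yes z~m = z~m
      ... | no z≁m = ⊥-elim (impossible (≤-trans (deg≥3 z)
              (≤-trans (deg≤ (ρ [ m ]≔ hi) (y ∷ []) near) (+-monoˡ-≤ 1 (shrink m∈)))))
        where
        near : ∀ {w} → z ~ w → (ρ [ m ]≔ hi) w ≡ mid ⊎ w ∈ y ∷ []
        near z~w with near-z z~w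
        ... | inj₁ ρw = inj₁ (still-mid z~w z≁m ρw)
        ... | inj₂ w∈ = inj₂ w∈
      adj-y : ∀ {m} → ρ m ≡ mid → y ~ m
      adj-y {m} m∈ with y ~? m
      ... | yes y~m = y~m
      ... | no y≁m = ⊥-elim (impossible (≤-trans 4≤deg
              (≤-trans (deg≤ (ρ [ m ]≔ hi) (x ∷ z ∷ []) near) (+-monoˡ-≤ 2 (shrink m∈)))))
        where
        near : ∀ {w} → y ~ w → (ρ [ m ]≔ hi) w ≡ mid ⊎ w ∈ x ∷ z ∷ []
        near {w} y~w with ρ w in ρw
        ... | mid = inj₁ (still-mid y~w y≁m ρw)
        ... | hi  = inj₂ (here (proj₂ (only (y~w , y∈lo , ρw))))
        ... | lo with pair ρw
        ...   | inj₁ w≡y = ⊥-elim (~⇒≢ y~w (≡.sym w≡y))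
        ...   | inj₂ w≡z = inj₂ (there (here w≡z))

    -- A vertex v of degree three has at most one neighbour on one of the two sides; it can
    -- change places with that neighbour.
    shift-unique : ∀ {ρ : Sides n} {c d v} → Good ρ c d → Sturdy d → ρ v ≡ mid →
                   (∀ {u w} → v ~ u → v ~ w → ρ u ≡ hi → ρ w ≡ hi → u ≡ w) →
                   ∃ λ τ → Good τ c d × τ v ≢ mid
    shift-unique {ρ} {c} {d} {v} good sturdy v∈ unique
      with any? (λ u → (v ~? u) ×-dec (ρ u ≟ˢ hi))
    ... | no ¬u = ⊥-elim (impossible (≤-trans (only⇒2≤ {ρ [ v ]≔ lo} only′ c∈ d∈) small′))
      where
      open Good good
      small′ : #mid (ρ [ v ]≔ lo) ≤ 1
      small′ = ≤-pred (≤-trans (#mid-shrink ρ v lo v∈ refl) small)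
      ≢mid : ∀ {u s} → s ≢ mid → ρ u ≡ s → v ≢ u
      ≢mid s≢ ρu refl = s≢ (trans (≡.sym ρu) v∈)
      c∈ : (ρ [ v ]≔ lo) c ≡ lo
      c∈ = trans (≔-other ρ lo (≢mid (λ ()) y∈lo)) y∈lo
      d∈ : (ρ [ v ]≔ lo) d ≡ hi
      d∈ = trans (≔-other ρ lo (≢mid (λ ()) x∈hi)) x∈hi
      only′ : Only (ρ [ v ]≔ lo) c d
      only′ {u} {w} (u~w , u∈ , w∈) with ≔-inv ρ v lo u∈ | ≔-inv ρ v lo w∈
      ... | _ | inj₁ (_ , ())
      ... | inj₁ (refl , _) | inj₂ (_ , ρw) = ⊥-elim (¬u (w , u~w , ρw))
      ... | inj₂ (_ , ρu) | inj₂ (_ , ρw) = only (u~w , ρu , ρw)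
    ... | yes (u , v~u , u∈) with u ≟ d
    -- When the only upper neighbour of `v` is `d`, moving `d` to the separator removes the old
    -- crossing edge and the one created by lowering `v`, while `more-hi` keeps the upper side
    -- inhabited.
    ...   | yes refl = ⊥-elim (connected {τ} un (at c≢u (at-v≢ (λ ()) y∈lo) y∈lo)
                                 (at (proj₁ (proj₂ more-hi) ∘ ≡.sym) (at-v≢ (λ ()) d₂∈) d₂∈) small′)
      where
      open Good good
      d₂∈ = proj₂ (proj₂ more-hi)
      τ = ρ [ v ]≔ lo [ u ]≔ mid
      at-v≢ : ∀ {w s} → s ≢ mid → ρ w ≡ s → v ≢ w
      at-v≢ s≢ ρw refl = s≢ (trans (≡.sym ρw) v∈)
      c≢u : u ≢ c
      c≢u refl with trans (≡.sym y∈lo) u∈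
      ... | ()
      at : ∀ {w s} → u ≢ w → v ≢ w → ρ w ≡ s → τ w ≡ s
      at u≢w v≢w ρw = trans (≔-other (ρ [ v ]≔ lo) mid u≢w) (trans (≔-other ρ lo v≢w) ρw)
      small′ : #mid τ ≤ 2
      small′ = ≤-trans (#mid-grow (ρ [ v ]≔ lo) u mid) (≤-trans (#mid-shrink ρ v lo v∈ refl) small)
      un : Uncrossed τ
      un cr with Cross-≔mid {ρ [ v ]≔ lo} cr
      ... | (a~b , a∈ , b∈) , u≢a , u≢b with ≔-inv ρ v lo a∈ | ≔-inv ρ v lo b∈
      ...   | _ | inj₁ (_ , ())
      ...   | inj₁ (refl , _) | inj₂ (_ , ρb) = u≢b (unique v~u a~b u∈ ρb)
      ...   | inj₂ (_ , ρa) | inj₂ (_ , ρb) = u≢b (≡.sym (proj₂ (only (a~b , ρa , ρb))))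
    ...   | no u≢d = τ , mkGood (mkSep y~x (at u≢c (at-v≢ (λ ()) y∈lo) y∈lo) (at u≢d (at-v≢ (λ ()) x∈hi) x∈hi) only′ small′)
                       (v , at-v≢ (λ ()) y∈lo , v∈lo) (proj₁ third , proj₁ (proj₂ third) , at (proj₁ (proj₂ (proj₂ third)))
                          (at-v≢ (λ ()) (proj₂ (proj₂ (proj₂ third)))) (proj₂ (proj₂ (proj₂ third)))) , v∉mid
      where
      open Good good
      τ = ρ [ v ]≔ lo [ u ]≔ mid
      at-v≢ : ∀ {w s} → s ≢ mid → ρ w ≡ s → v ≢ w
      at-v≢ s≢ ρw refl = s≢ (trans (≡.sym ρw) v∈)
      u≢c : u ≢ c
      u≢c refl with trans (≡.sym y∈lo) u∈
      ... | ()
      at : ∀ {w s} → u ≢ w → v ≢ w → ρ w ≡ s → τ w ≡ s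
      at u≢w v≢w ρw = trans (≔-other (ρ [ v ]≔ lo) mid u≢w) (trans (≔-other ρ lo v≢w) ρw)
      v∈lo : τ v ≡ lo
      v∈lo = trans (≔-other (ρ [ v ]≔ lo) mid (λ u≡v → ~⇒≢ v~u (≡.sym u≡v))) (≔-same ρ v lo)
      v∉mid : τ v ≢ mid
      v∉mid eq with trans (≡.sym v∈lo) eq
      ... | ()
      small′ : #mid τ ≤ 2
      small′ = ≤-trans (#mid-grow (ρ [ v ]≔ lo) u mid) (≤-trans (#mid-shrink ρ v lo v∈ refl) small)
      only′ : Only τ c d
      only′ cr with Cross-≔mid {ρ [ v ]≔ lo} cr
      ... | (a~b , a∈ , b∈) , u≢a , u≢b with ≔-inv ρ v lo a∈ | ≔-inv ρ v lo b∈
      ...   | _ | inj₁ (_ , ())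
      ...   | inj₁ (refl , _) | inj₂ (_ , ρb) = ⊥-elim (u≢b (unique v~u a~b u∈ ρb))
      ...   | inj₂ (_ , ρa) | inj₂ (_ , ρb) = only (a~b , ρa , ρb)
      -- If the upper side were just `d` and `u`, `lo-pair` for the reversed separation would make
      -- `d` a second upper neighbour of `v`.
      third : ∃ λ w → w ≢ d × u ≢ w × ρ w ≡ hi
      third with any? (λ w → ¬? (w ≟ d) ×-dec (¬? (u ≟ w) ×-dec (ρ w ≟ˢ hi)))
      ... | yes p = p
      ... | no ¬p = ⊥-elim (u≢d (unique v~u (~-sym (proj₁ (proj₂ pair v∈ᵒ))) u∈ x∈hi))
        where
        v∈ᵒ : (ρ ᵒ) v ≡ mid
        v∈ᵒ = cong flip v∈
        only-two : ∀ {w} → (ρ ᵒ) w ≡ lo → w ≡ d ⊎ w ≡ u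
        only-two {w} w∈ with w ≟ d | u ≟ w
        ... | yes w≡d | _ = inj₁ w≡d
        ... | no _ | yes u≡w = inj₂ (≡.sym u≡w)
        ... | no w≢d | no u≢w = ⊥-elim (¬p (w , w≢d , u≢w , flip-lo w∈))
        pair = lo-pair (Good-ᵒ good) sturdy u≢d (cong flip u∈) only-two

    -- Uncrossing needs its reference vertex outside the separator of the second separation. For a
    -- vertex of degree three this can always be arranged without changing the crossing edge,
    -- reversing the separation if the side with a unique neighbour is the lower one.
    shift : ∀ {ρ : Sides n} {c d v} → Good ρ c d → Sturdy c → Sturdy d → deg v ≤ 3 →
            ∃ λ τ → Good τ c d × τ v ≢ mid
    shift {ρ} {c} {d} {v} good sc sd deg-v with ρ v ≟ˢ mid
    ... | no v∉mid = ρ , good , v∉mid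
    ... | yes v∈ with unique-side {ρ} deg-v
    ...   | inj₁ unique = shift-unique good sd v∈ unique
    ...   | inj₂ unique =
            let τ , good′ , v∉ = shift-unique (Good-ᵒ good) sc (cong flip v∈)
                                   (λ v~a v~b a∈ b∈ → unique v~a v~b (flip-hi a∈) (flip-hi b∈))
            in τ ᵒ , Good-ᵒ good′ , v∉ ∘ flip-mid

-- Uncrossing

module _ {n : ℕ} (G : Graph n) where
  open Separations G

  module Uncross
    (connected : ∀ {ρ : Sides n} {l r} → Uncrossed ρ → ρ l ≡ lo → ρ r ≡ hi → #mid ρ ≤ 2 → ⊥)
    (deg≥3 : ∀ v → 3 ≤ deg v)
    where
    open Connected connected deg≥3

    module Corners {ρ τ : Sides n} {y x c d r : Fin n}
      (gρ : Good ρ y x) (gτ : Good τ c d) (sy : Sturdy y) (sc : Sturdy c)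
      (ρc : ρ c ≡ lo) (distinct : ¬ (c ≡ y × d ≡ x)) (ρr : ρ r ≡ hi)
      where

      open Good gρ
      open Good gτ using () renaming
        (y~x to c~d; y∈lo to τc; x∈hi to τd; only to onlyτ; small to smallτ;
         more-lo to more-loτ; more-hi to more-hiτ)

      -- The result carries one of the two old edges, so properties of their ends survive. The edge
      -- `c d` may be turned around because `NW` sees `τ` reversed. Keeping `r` on the upper side
      -- allows the descent to be repeated.
      Smaller : Set
      Smaller = ∃ λ σ → (Good σ y x ⊎ Good σ c d ⊎ Good σ d c) × σ r ≡ hi × #lo σ < #lo ρ

      -- The lower side of each corner is the intersection of a side of ρ with a side of τ.
      NE SW NW SE : Sides n
      NE = ρ ⊔̇ τ
      SW = ρ ᵒ ⊔̇ τ ᵒ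
      NW = ρ ⊔̇ τ ᵒ
      SE = ρ ᵒ ⊔̇ τ

      NE+SW : #mid NE + #mid SW ≤ 4
      NE+SW = ≤-trans (≤-reflexive (#mid-modular ρ τ)) (+-mono-≤ small smallτ)

      NW+SE : #mid NW + #mid SE ≤ 4
      NW+SE = ≤-trans (≤-reflexive (trans (cong (#mid NW +_) (sum-cong-≗ λ v →
                cong (λ s → isMid (flip (ρ v) ⊔ s)) (≡.sym (flip-flip (τ v))))) (#mid-modular ρ (τ ᵒ))))
              (+-mono-≤ small (≤-trans (≤-reflexive (#mid-ᵒ τ)) smallτ))

      ρd≢hi : ρ d ≢ hi
      ρd≢hi ρd = distinct (only (c~d , ρc , ρd))

      ¬τyx : τ y ≡ lo → τ x ≢ hi
      ¬τyx τy τx with onlyτ (y~x , τy , τx)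
      ... | refl , refl = distinct (refl , refl)

      ¬τxy : τ x ≡ lo → τ y ≢ hi
      ¬τxy τx τy with onlyτ (~-sym y~x , τx , τy)
      ... | refl , refl = clash ρc x∈hi (lo≢hi ∘ ≡.sym)

      cross-NE : ∀ {u w} → Cross NE u w → (u ≡ y × w ≡ x × τ y ≡ lo) ⊎ (u ≡ c × w ≡ d)
      cross-NE cr with Cross-⊔ {ρ} {τ} cr
      ... | inj₂ (crτ , _) = inj₂ (onlyτ crτ)
      ... | inj₁ (crρ , τu) with only crρ
      ...   | refl , refl = inj₁ (refl , refl , τu)

      cross-SW : ∀ {u w} → Cross SW u w → u ≡ x × w ≡ y × τ x ≡ hi
      cross-SW cr with Cross-⊔ {ρ ᵒ} {τ ᵒ} cr
      ... | inj₁ (crρ , τu) with only (Cross-ᵒ {ρ} crρ)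
      ...   | refl , refl = refl , refl , flip-lo τu
      cross-SW cr | inj₂ (crτ , ρu) with onlyτ (Cross-ᵒ {τ} crτ)
      ...   | refl , refl = ⊥-elim (ρd≢hi (flip-lo ρu))

      cross-NW : ∀ {u w} → Cross NW u w → (u ≡ y × w ≡ x × τ y ≡ hi) ⊎ (u ≡ d × w ≡ c × ρ d ≡ lo)
      cross-NW cr with Cross-⊔ {ρ} {τ ᵒ} cr
      ... | inj₁ (crρ , τu) with only crρ
      ...   | refl , refl = inj₁ (refl , refl , flip-lo τu)
      cross-NW cr | inj₂ (crτ , ρu) with onlyτ (Cross-ᵒ {τ} crτ)
      ...   | refl , refl = inj₂ (refl , refl , ρu)

      cross-SE : ∀ {u w} → Cross SE u w → u ≡ x × w ≡ y × τ x ≡ lo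
      cross-SE cr with Cross-⊔ {ρ ᵒ} {τ} cr
      ... | inj₁ (crρ , τu) with only (Cross-ᵒ {ρ} crρ)
      ...   | refl , refl = refl , refl , τu
      cross-SE cr | inj₂ (crτ , ρu) with onlyτ crτ
      ...   | refl , refl = clash ρc (flip-lo ρu) (lo≢hi ∘ ≡.sym)

      NE-r : NE r ≡ hi
      NE-r = hi⊔ (τ r) ρr
      NW-r : NW r ≡ hi
      NW-r = hi⊔ (flip (τ r)) ρr
      NW-x : NW x ≡ hi
      NW-x = hi⊔ (flip (τ x)) x∈hi
      SW-y : SW y ≡ hi
      SW-y = hi⊔ (flip (τ y)) (cong flip y∈lo)
      SE-y : SE y ≡ hi
      SE-y = hi⊔ (τ y) (cong flip y∈lo)
      NE-c : NE c ≡ lo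
      NE-c = ≡⊔ ρc τc
      NE-d : NE d ≡ hi
      NE-d = ⊔hi (ρ d) τd
      NW-c : NW c ≡ hi
      NW-c = ⊔hi (ρ c) (cong flip τc)

      c≢r : c ≢ r
      c≢r refl = clash ρc ρr (lo≢hi ∘ ≡.sym)

      r≢d : r ≢ d
      r≢d refl = ρd≢hi ρr

      lo≢ : ∀ {u w} → ρ u ≡ lo → ρ w ≡ hi → u ≢ w
      lo≢ ρu ρw refl = clash ρu ρw (lo≢hi ∘ ≡.sym)

      -- Only `x y` can cross `SE`. One separating vertex leaves at most `x` on its lower side, and
      -- then a single crossing edge would require two separating vertices.
      SE-empty : #mid SE ≤ 1 → ∀ {u} → SE u ≢ lo
      SE-empty ≤1 {u} u∈ with only-lo {SE} (proj₁ ∘ cross-SE) SE-y ≤1 u u∈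
      ... | refl = impossible (≤-trans (only⇒2≤ {SE} (λ cr → let a , b , _ = cross-SE cr in a , b) u∈ SE-y) ≤1)

      -- With a single vertex in the separator of `NE`, the lower side of `σ` is exactly a pair, so
      -- `lo-pair` applies.
      mid-pair : ∀ {σ e f} → Good σ e f → Sturdy e → #mid NE ≤ 1 →
                 (∀ {u} → σ u ≡ lo → u ≡ e ⊎ NE u ≡ mid) → 4 ≤ deg e
      mid-pair {σ} {e} gσ se ≤1 cover with Good.more-lo gσ
      ... | t , t≢e , σt with cover σt
      ...   | inj₁ t≡e = ⊥-elim (t≢e t≡e)
      ...   | inj₂ NEt = proj₁ (lo-pair gσ se t≢e σt two)
        where
        two : ∀ {u} → σ u ≡ lo → u ≡ e ⊎ u ≡ t
        two {u} σu with cover σu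
        ... | inj₁ u≡e = inj₁ u≡e
        ... | inj₂ NEu with u ≟ t
        ...   | yes u≡t = inj₂ u≡t
        ...   | no u≢t = ⊥-elim (impossible (≤-trans
                  (mids≤ NE {u ∷ t ∷ []} ((u≢t ∷ []) ∷ [] ∷ []) (NEu ∷ NEt ∷ [])) ≤1))

      sturdy-nbr : deg c ≤ 3 → 4 ≤ deg d
      sturdy-nbr deg-c with 4 ≤? deg d
      ... | yes p = p
      ... | no ¬p = ⊥-elim (impossible (≤-trans (sc c~d (≤-pred (≰⇒> ¬p))) deg-c))

      ρ-more-hi : ∀ {σ : Sides n} → (∀ {w} → ρ w ≡ hi → σ w ≡ hi) → ∃ λ w → w ≢ x × σ w ≡ hi
      ρ-more-hi keep = let w , w≢x , ρw = more-hi in w , w≢x , keep ρw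

      -- There is room for one more separating vertex, so `c` is moved to the separator of `NE`,
      -- which disposes of `c d` and keeps `y x`. If nothing but `y` remained on the lower side, `y`
      -- and `c` would be adjacent vertices of degree three.
      small-NE : #mid NE ≤ 1 → Smaller
      small-NE ≤1 with τ y ≟ˢ lo
      ... | no τy≢lo = ⊥-elim (impossible (≤-trans (only⇒2≤ {NE} only′ NE-c NE-d) ≤1))
        where
        only′ : Only NE c d
        only′ cr with cross-NE cr
        ... | inj₁ (_ , _ , τy) = ⊥-elim (τy≢lo τy)
        ... | inj₂ eqs = eqs
      ... | yes τy with y ≟ c
      ...   | no y≢c = result
        where
        σ : Sides n
        σ = NE [ c ]≔ mid
        NE-y : NE y ≡ lo
        NE-y = ≡⊔ y∈lo τy
        keep-hi : ∀ {w} → ρ w ≡ hi → σ w ≡ hi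
        keep-hi {w} ρw = trans (≔-other NE mid (lo≢ ρc ρw)) (hi⊔ (τ w) ρw)
        only′ : Only σ y x
        only′ cr with Cross-≔mid {NE} cr
        ... | cr′ , c≢u , _ with cross-NE cr′
        ...   | inj₁ (eq , eq′ , _) = eq , eq′
        ...   | inj₂ (eq , _) = ⊥-elim (c≢u (≡.sym eq))
        sep-σ : Sep σ y x
        sep-σ = mkSep y~x (trans (≔-other NE mid (y≢c ∘ ≡.sym)) NE-y) (keep-hi x∈hi) only′
                      (≤-trans (#mid-grow NE c mid) (s≤s ≤1))
        strict : #lo σ < #lo ρ
        strict = #lo-strict c (λ v σv → case ≔-inv NE c mid σv of λ where
                   (inj₂ (c≢v , NEv)) → proj₁ (⊔-lo NEv) , c≢v ∘ ≡.sym) ρc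
        result : Smaller
        result with lo-other? σ y
        ... | yes other = σ , inj₁ (mkGood sep-σ other (ρ-more-hi keep-hi)) , keep-hi ρr , strict
        ... | no ¬other = ⊥-elim (impossible (≤-trans (sy y~c deg-c) deg-y))
          where
          two : ∀ {u} → NE u ≡ lo → u ≡ y ⊎ u ≡ c
          two {u} NEu with u ≟ y | c ≟ u
          ... | yes eq | _ = inj₁ eq
          ... | no _ | yes eq = inj₂ (≡.sym eq)
          ... | no u≢y | no c≢u = ⊥-elim (¬other (u , u≢y , trans (≔-other NE mid c≢u) NEu))
          near-y : ∀ {w} → y ~ w → NE w ≡ mid ⊎ w ∈ x ∷ c ∷ []
          near-y {w} y~w with NE w in NEw
          ... | mid = inj₁ refl
          ... | hi with cross-NE (y~w , NE-y , NEw)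
          ...   | inj₁ (_ , eq , _) = inj₂ (here eq)
          ...   | inj₂ (eq , _) = ⊥-elim (y≢c eq)
          near-y {w} y~w | lo with two NEw
          ...   | inj₁ eq = ⊥-elim (~⇒≢ y~w (≡.sym eq))
          ...   | inj₂ eq = inj₂ (there (here eq))
          near-c : ∀ {w} → c ~ w → NE w ≡ mid ⊎ w ∈ d ∷ y ∷ []
          near-c {w} c~w with NE w in NEw
          ... | mid = inj₁ refl
          ... | hi with cross-NE (c~w , NE-c , NEw)
          ...   | inj₁ (eq , _) = ⊥-elim (y≢c (≡.sym eq))
          ...   | inj₂ (_ , eq) = inj₂ (here eq)
          near-c {w} c~w | lo with two NEw
          ...   | inj₁ eq = inj₂ (there (here eq))
          ...   | inj₂ eq = ⊥-elim (~⇒≢ c~w (≡.sym eq))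
          deg-y : deg y ≤ 3
          deg-y = ≤-trans (deg≤ NE (x ∷ c ∷ []) near-y) (+-monoˡ-≤ 2 ≤1)
          deg-c : deg c ≤ 3
          deg-c = ≤-trans (deg≤ NE (d ∷ y ∷ []) near-c) (+-monoˡ-≤ 2 ≤1)
          y~c : y ~ c
          y~c with y ~? c
          ... | yes p = p
          ... | no y≁c = ⊥-elim (impossible (≤-trans (deg≥3 y) (≤-trans (deg≤ NE (x ∷ []) near) (+-monoˡ-≤ 1 ≤1))))
            where
            near : ∀ {w} → y ~ w → NE w ≡ mid ⊎ w ∈ x ∷ []
            near y~w with near-y y~w
            ... | inj₁ NEw = inj₁ NEw
            ... | inj₂ (here eq) = inj₂ (here eq)
            ... | inj₂ (there (here refl)) = ⊥-elim (y≁c y~w)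
      -- Both edges leave `y`, which cannot be sacrificed. It is the whole lower side of `NE` and
      -- has degree at most three; the corner `NW` with the edge `d y` takes over, or one of the two
      -- lower sides is a pair, contradicting that degree.
      ...   | yes refl = result
        where
        from-y : ∀ {u w} → Cross NE u w → u ≡ y
        from-y cr with cross-NE cr
        ... | inj₁ (eq , _) = eq
        ... | inj₂ (eq , _) = eq
        single : ∀ {u} → NE u ≡ lo → u ≡ y
        single = only-lo {NE} from-y NE-r ≤1 _
        near-y : ∀ {w} → y ~ w → NE w ≡ mid ⊎ w ∈ x ∷ d ∷ []
        near-y {w} y~w with NE w in NEw
        ... | mid = inj₁ refl
        ... | lo  = ⊥-elim (~⇒≢ y~w (≡.sym (single NEw)))
        ... | hi with cross-NE (y~w , NE-c , NEw)
        ...   | inj₁ (_ , eq , _) = inj₂ (here eq)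
        ...   | inj₂ (_ , eq) = inj₂ (there (here eq))
        deg-y : deg y ≤ 3
        deg-y = ≤-trans (deg≤ NE (x ∷ d ∷ []) near-y) (+-monoˡ-≤ 2 ≤1)
        large-NW : 3 ≤ #mid NW → ⊥
        large-NW 3≤ = impossible (≤-trans (mid-pair gτ sc ≤1 cover) deg-y)
          where
          cover : ∀ {u} → τ u ≡ lo → u ≡ y ⊎ NE u ≡ mid
          cover {u} τu with ρ u in ρu
          ... | lo  = inj₁ (single (≡⊔ ρu τu))
          ... | mid = inj₂ (≡⊔ {mid} {τ u} refl τu)
          ... | hi  = ⊥-elim (SE-empty (rest≤′ 3 NW+SE 3≤) (≡⊔ (cong flip ρu) τu))
        result : Smaller
        result with ρ d in ρd
        ... | hi = ⊥-elim (ρd≢hi ρd)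
        ... | lo with 3 ≤? #mid NW
        ...   | yes 3≤ = ⊥-elim (large-NW 3≤)
        ...   | no ¬3≤ = NW , inj₂ (inj₂ (mkGood sep-NW other (r , c≢r ∘ ≡.sym , NW-r))) , NW-r , strict
          where
          ≤2 : #mid NW ≤ 2
          ≤2 = ≤-pred (≰⇒> ¬3≤)
          NW-d : NW d ≡ lo
          NW-d = ≡⊔ ρd (cong flip τd)
          only′ : Only NW d y
          only′ cr with cross-NW cr
          ... | inj₁ (_ , _ , τy′) = clash τy τy′ (lo≢hi ∘ ≡.sym)
          ... | inj₂ (eq , eq′ , _) = eq , eq′
          sep-NW : Sep NW d y
          sep-NW = mkSep (~-sym c~d) NW-d NW-c only′ ≤2
          other : ∃ λ u → u ≢ d × NW u ≡ lo
          other with lo-other? NW d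
          ... | yes p = p
          ... | no ¬p = ⊥-elim (impossible (≤-trans (sturdy-nbr deg-y) (≤-trans (deg≤ NW (y ∷ []) near) (+-monoˡ-≤ 1 ≤2))))
            where
            near : ∀ {w} → d ~ w → NW w ≡ mid ⊎ w ∈ y ∷ []
            near {w} d~w with NW w in NWw
            ... | mid = inj₁ refl
            ... | hi  = inj₂ (here (proj₂ (only′ (d~w , NW-d , NWw))))
            ... | lo  = ⊥-elim (¬p (w , (~⇒≢ d~w ∘ ≡.sym) , NWw))
          strict : #lo NW < #lo ρ
          strict = #lo-strict y (λ v NWv → proj₁ (⊔-lo NWv) , λ {refl → clash NWv NW-c (lo≢hi ∘ ≡.sym)}) ρc
        result | mid with any? (λ u → NW u ≟ˢ lo)
        ...   | yes (u , NWu) = ⊥-elim (large-NW (uncrossed⇒3≤ {NW} un NWu NW-r))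
          where
          un : Uncrossed NW
          un cr with cross-NW cr
          ... | inj₁ (_ , _ , τy′) = clash τy τy′ (lo≢hi ∘ ≡.sym)
          ... | inj₂ (_ , _ , ρd′) = clash ρd′ ρd (lo≢mid ∘ ≡.sym)
        ...   | no empty = ⊥-elim (impossible (≤-trans (mid-pair gρ sy ≤1 cover) deg-y))
          where
          cover : ∀ {u} → ρ u ≡ lo → u ≡ y ⊎ NE u ≡ mid
          cover {u} ρu with τ u in τu
          ... | lo  = inj₁ (single (≡⊔ ρu τu))
          ... | mid = inj₂ (≡⊔ {ρ u} {mid} ρu refl)
          ... | hi  = ⊥-elim (empty (u , ≡⊔ ρu (cong flip τu)))

      -- The corner `SW` contains `r`. Its separator has at least three vertices if `x y` does not
      -- cross it and at least two if it does, which leaves at most one or two for `NE`.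
      far-hi : τ r ≡ hi → Smaller
      far-hi τr with τ x ≟ˢ hi
      ... | no τx≢hi = small-NE (rest≤ 3 NE+SW (uncrossed⇒3≤ {SW}
                         (λ cr → τx≢hi (proj₂ (proj₂ (cross-SW cr)))) (≡⊔ (cong flip ρr) (cong flip τr)) SW-y))
      ... | yes τx = result
        where
        τy≢lo : τ y ≢ lo
        τy≢lo τy = ¬τyx τy τx
        ≤2 : #mid NE ≤ 2
        ≤2 = rest≤ 2 NE+SW (only⇒2≤ {SW} (λ cr → let a , b , _ = cross-SW cr in a , b)
               (≡⊔ (cong flip x∈hi) (cong flip τx)) SW-y)
        only′ : Only NE c d
        only′ cr with cross-NE cr
        ... | inj₁ (_ , _ , τy) = ⊥-elim (τy≢lo τy)
        ... | inj₂ eqs = eqs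
        result : Smaller
        result with lo-other? NE c
        ... | yes other = NE , inj₂ (inj₁ (mkGood (mkSep c~d NE-c NE-d only′ ≤2) other (r , r≢d , NE-r))) , NE-r ,
                #lo-strict y (λ v NEv → proj₁ (⊔-lo NEv) , λ {refl → τy≢lo (proj₂ (⊔-lo NEv))}) y∈lo
        -- Now `c` is the whole lower side of `NE` and has degree three, so `d` has degree at least
        -- four by sturdiness of `c`.
        ... | no ¬other = conclude
          where
          single : ∀ {u} → NE u ≡ lo → u ≡ c
          single {u} NEu with u ≟ c
          ... | yes eq = eq
          ... | no u≢c = ⊥-elim (¬other (u , u≢c , NEu))
          near-c : ∀ {w} → c ~ w → NE w ≡ mid ⊎ w ∈ d ∷ []
          near-c {w} c~w with NE w in NEw
          ... | mid = inj₁ refl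
          ... | lo  = ⊥-elim (~⇒≢ c~w (≡.sym (single NEw)))
          ... | hi  = inj₂ (here (proj₂ (only′ (c~w , NE-c , NEw))))
          deg-c : deg c ≤ 3
          deg-c = ≤-trans (deg≤ NE (d ∷ []) near-c) (+-monoˡ-≤ 1 ≤2)
          deg-d : 4 ≤ deg d
          deg-d = sturdy-nbr deg-c
          -- The room in the separator of `NW` is given to `d`, so that `y x` is the only crossing
          -- edge left. The other positions of `y` and `d` leave one crossing edge with at most one
          -- separating vertex, put both into the separator, or bound the degree of `d` by three.
          small-NW : #mid NW ≤ 1 → Smaller
          small-NW ≤1 with ρ d in ρd
          ... | hi = ⊥-elim (ρd≢hi ρd)
          ... | mid with τ y in τy
          ...   | lo = ⊥-elim (τy≢lo τy)
          ...   | hi = ⊥-elim (impossible (≤-trans (only⇒2≤ {NW} only″ (≡⊔ y∈lo (cong flip τy)) NW-x) ≤1))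
            where
            only″ : Only NW y x
            only″ cr with cross-NW cr
            ... | inj₁ (eq , eq′ , _) = eq , eq′
            ... | inj₂ (_ , _ , ρd′) = clash ρd′ ρd (lo≢mid ∘ ≡.sym)
          ...   | mid = ⊥-elim (impossible (≤-trans (mids≤ NW {d ∷ y ∷ []} ((d≢y ∷ []) ∷ [] ∷ [])
                          (≡⊔ ρd (cong flip τd) ∷ ≡⊔ y∈lo (cong flip τy) ∷ [])) ≤1))
            where
            d≢y : d ≢ y
            d≢y refl = clash y∈lo ρd (lo≢mid ∘ ≡.sym)
          small-NW ≤1 | lo with τ y ≟ˢ hi
          ...   | no τy≢hi = ⊥-elim (impossible (≤-trans (only⇒2≤ {NW} only″ (≡⊔ ρd (cong flip τd)) NW-c) ≤1))
            where
            only″ : Only NW d c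
            only″ cr with cross-NW cr
            ... | inj₁ (_ , _ , τy) = ⊥-elim (τy≢hi τy)
            ... | inj₂ (eq , eq′ , _) = eq , eq′
          ...   | yes τy with y ≟ d
          ...     | yes refl = ⊥-elim (impossible (≤-trans deg-d
                        (≤-trans (deg≤ NW (x ∷ c ∷ []) near) (+-monoˡ-≤ 2 ≤1))))
            where
            from-y : ∀ {u w} → Cross NW u w → u ≡ y
            from-y cr with cross-NW cr
            ... | inj₁ (eq , _) = eq
            ... | inj₂ (eq , _) = eq
            near : ∀ {w} → y ~ w → NW w ≡ mid ⊎ w ∈ x ∷ c ∷ []
            near {w} y~w with NW w in NWw
            ... | mid = inj₁ refl
            ... | lo  = ⊥-elim (~⇒≢ y~w (≡.sym (only-lo {NW} from-y NW-r ≤1 w NWw)))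
            ... | hi with cross-NW (y~w , ≡⊔ ρd (cong flip τd) , NWw)
            ...   | inj₁ (_ , eq , _) = inj₂ (here eq)
            ...   | inj₂ (_ , eq , _) = inj₂ (there (here eq))
          ...     | no y≢d = result′
            where
            σ : Sides n
            σ = NW [ d ]≔ mid
            keep-hi : ∀ {w} → ρ w ≡ hi → σ w ≡ hi
            keep-hi {w} ρw = trans (≔-other NW mid (lo≢ ρd ρw)) (hi⊔ (flip (τ w)) ρw)
            only″ : Only σ y x
            only″ cr with Cross-≔mid {NW} cr
            ... | cr′ , d≢u , _ with cross-NW cr′
            ...   | inj₁ (eq , eq′ , _) = eq , eq′
            ...   | inj₂ (eq , _) = ⊥-elim (d≢u (≡.sym eq))
            result′ : Smaller
            result′ with lo-other? σ y
            ... | yes other = σ , inj₁ (mkGood (mkSep y~x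
                      (trans (≔-other NW mid (y≢d ∘ ≡.sym)) (≡⊔ y∈lo (cong flip τy))) (keep-hi x∈hi) only″
                      (≤-trans (#mid-grow NW d mid) (s≤s ≤1))) other (ρ-more-hi keep-hi)) , keep-hi ρr ,
                    #lo-strict d (λ v σv → case ≔-inv NW d mid σv of λ where
                      (inj₂ (d≢v , NWv)) → proj₁ (⊔-lo NWv) , d≢v ∘ ≡.sym) ρd
            ... | no ¬other′ = ⊥-elim (impossible (≤-trans deg-d
                        (≤-trans (deg≤ NW (y ∷ c ∷ []) near) (+-monoˡ-≤ 2 ≤1))))
              where
              near : ∀ {w} → d ~ w → NW w ≡ mid ⊎ w ∈ y ∷ c ∷ []
              near {w} d~w with NW w in NWw
              ... | mid = inj₁ refl
              ... | hi with cross-NW (d~w , ≡⊔ ρd (cong flip τd) , NWw)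
              ...   | inj₁ (eq , _) = ⊥-elim (y≢d (≡.sym eq))
              ...   | inj₂ (_ , eq , _) = inj₂ (there (here eq))
              near {w} d~w | lo with w ≟ y
              ...   | yes eq = inj₂ (here eq)
              ...   | no w≢y = ⊥-elim (¬other′ (w , w≢y , trans (≔-other NW mid (~⇒≢ d~w)) NWw))
          conclude : Smaller
          conclude with #mid NW ≤? 1
          ... | yes ≤1 = small-NW ≤1
          ... | no ¬≤1 = ⊥-elim absurd
            where
            SE≤2 : #mid SE ≤ 2
            SE≤2 = rest≤′ 2 NW+SE (≰⇒> ¬≤1)
            un : Uncrossed SE
            un cr = clash (proj₂ (proj₂ (cross-SE cr))) τx (lo≢hi ∘ ≡.sym)
            in-mid : ∀ {u} → u ≢ c → τ u ≡ lo → ρ u ≡ mid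
            in-mid {u} u≢c τu with ρ u in ρu
            ... | lo  = ⊥-elim (u≢c (single (≡⊔ ρu τu)))
            ... | mid = refl
            ... | hi  = ⊥-elim (impossible (≤-trans
                          (uncrossed⇒3≤ {SE} un (≡⊔ (cong flip ρu) τu) SE-y) SE≤2))
            -- Beyond `c`, the lower side of `τ` lies in the separator of `ρ`. A single such vertex
            -- contradicts `lo-pair`; two of them exhaust the separators of `ρ` and `NE`, and
            -- nothing is left for that of `NW`.
            absurd : ⊥
            absurd with more-loτ
            ... | t , t≢c , τt with any? (λ u → ¬? (u ≟ c) ×-dec (¬? (u ≟ t) ×-dec (τ u ≟ˢ lo)))
            ...   | no ¬third = impossible (≤-trans (proj₁ (lo-pair gτ sc t≢c τt two)) deg-c)
              where
              two : ∀ {u} → τ u ≡ lo → u ≡ c ⊎ u ≡ t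
              two {u} τu with u ≟ c | u ≟ t
              ... | yes eq | _ = inj₁ eq
              ... | no _ | yes eq = inj₂ eq
              ... | no u≢c | no u≢t = ⊥-elim (¬third (u , u≢c , u≢t , τu))
            ...   | yes (t′ , t′≢c , t′≢t , τt′) = ¬≤1 (≤-trans (≤-reflexive (sum-zero no-mid)) z≤n)
              where
              third-mid : ∀ (σ : Sides n) {u} → #mid σ ≤ 2 → σ t ≡ mid → σ t′ ≡ mid → σ u ≡ mid → τ u ≡ lo
              third-mid σ {u} ≤2′ σt σt′ σu with u ≟ t | u ≟ t′
              ... | yes refl | _ = τt
              ... | no _ | yes refl = τt′
              ... | no u≢t | no u≢t′ = ⊥-elim (impossible (≤-trans
                      (mids≤ σ {u ∷ t ∷ t′ ∷ []} ((u≢t ∷ u≢t′ ∷ []) ∷ ((t′≢t ∘ ≡.sym) ∷ []) ∷ [] ∷ [])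
                        (σu ∷ σt ∷ σt′ ∷ [])) ≤2′))
              ρt = in-mid t≢c τt
              ρt′ = in-mid t′≢c τt′
              no-mid : ∀ v → isMid (NW v) ≡ 0
              no-mid v with ρ v in ρv | τ v in τv
              ... | hi  | _  = refl
              ... | lo  | lo = refl
              ... | lo  | hi = refl
              ... | mid | lo = refl
              ... | mid | mid = clash (third-mid ρ small ρt ρt′ ρv) τv (lo≢mid ∘ ≡.sym)
              ... | mid | hi  = clash (third-mid ρ small ρt ρt′ ρv) τv (lo≢hi ∘ ≡.sym)
              ... | lo  | mid = clash (third-mid NE ≤2 (≡⊔ ρt τt) (≡⊔ ρt′ τt′) (≡⊔ ρv τv)) τv (lo≢mid ∘ ≡.sym)

      -- Here `SE` contains `r`. If `SW` is inhabited too, `NE` or `NW` gets at most one separating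
      -- vertex. Otherwise `SW` and `NW` are both empty, the upper side of `τ` lies in the separator
      -- of `ρ`, and `τ` reversed is itself the smaller separation, unless the lower side of `ρ` has
      -- only two vertices.
      far-lo : τ r ≡ lo → ρ d ≡ mid → Smaller
      far-lo τr ρd with any? (λ u → SW u ≟ˢ lo)
      ... | yes (l , SWl) = corner
        where
        corner : Smaller
        corner with τ x ≟ˢ hi
        ... | no τx≢hi = small-NE (rest≤ 3 NE+SW (uncrossed⇒3≤ {SW} (λ cr → τx≢hi (proj₂ (proj₂ (cross-SW cr)))) SWl SW-y))
        ... | yes τx = ⊥-elim absurd
          where
          ≤1 : #mid NW ≤ 1
          ≤1 = rest≤ 3 NW+SE (uncrossed⇒3≤ {SE} (λ cr → clash (proj₂ (proj₂ (cross-SE cr))) τx (lo≢hi ∘ ≡.sym))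
                 (≡⊔ (cong flip ρr) τr) SE-y)
          only″ : Only NW y x
          only″ cr with cross-NW cr
          ... | inj₁ (eq , eq′ , _) = eq , eq′
          ... | inj₂ (_ , _ , ρd′) = clash ρd′ ρd (lo≢mid ∘ ≡.sym)
          d≢y : d ≢ y
          d≢y refl = clash y∈lo ρd (lo≢mid ∘ ≡.sym)
          absurd : ⊥
          absurd with τ y in τy
          ... | lo  = ¬τyx τy τx
          ... | hi  = impossible (≤-trans (only⇒2≤ {NW} only″ (≡⊔ y∈lo (cong flip τy)) NW-x) ≤1)
          ... | mid = impossible (≤-trans (mids≤ NW {d ∷ y ∷ []} ((d≢y ∷ []) ∷ [] ∷ [])
                        (≡⊔ ρd (cong flip τd) ∷ ≡⊔ y∈lo (cong flip τy) ∷ [])) ≤1)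
      ... | no SW-empty = finish
        where
        NW-empty : ∀ {u} → NW u ≢ lo
        NW-empty {u} NWu with τ x ≟ˢ lo
        ... | yes τx = impossible (≤-trans (uncrossed⇒3≤ {NW} un NWu NW-r)
                         (rest≤ 2 NW+SE (only⇒2≤ {SE} (λ cr → let a , b , _ = cross-SE cr in a , b)
                           (≡⊔ (cong flip x∈hi) τx) SE-y)))
          where
          un : Uncrossed NW
          un cr with cross-NW cr
          ... | inj₁ (_ , _ , τy) = ¬τxy τx τy
          ... | inj₂ (_ , _ , ρd′) = clash ρd′ ρd (lo≢mid ∘ ≡.sym)
        ... | no τx≢lo = second
          where
          ≤1 : #mid NW ≤ 1
          ≤1 = rest≤ 3 NW+SE (uncrossed⇒3≤ {SE} (λ cr → τx≢lo (proj₂ (proj₂ (cross-SE cr))))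
                 (≡⊔ (cong flip ρr) τr) SE-y)
          only″ : Only NW y x
          only″ cr with cross-NW cr
          ... | inj₁ (eq , eq′ , _) = eq , eq′
          ... | inj₂ (_ , _ , ρd′) = clash ρd′ ρd (lo≢mid ∘ ≡.sym)
          second : ⊥
          second with only-lo {NW} (proj₁ ∘ only″) NW-r ≤1 u NWu
          ... | refl = impossible (≤-trans (only⇒2≤ {NW} only″ NWu NW-x) ≤1)
        in-mid : ∀ {u} → τ u ≡ hi → ρ u ≡ mid
        in-mid {u} τu with ρ u in ρu
        ... | lo  = ⊥-elim (NW-empty (≡⊔ ρu (cong flip τu)))
        ... | mid = refl
        ... | hi  = ⊥-elim (SW-empty (u , ≡⊔ (cong flip ρu) (cong flip τu)))
        #lo-τᵒ : #lo (τ ᵒ) ≤ 2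
        #lo-τᵒ = ≤-trans (sum-mono pointwise) small
          where
          pointwise : ∀ v → isLo (flip (τ v)) ≤ isMid (ρ v)
          pointwise v with τ v in τv
          ... | lo  = z≤n
          ... | mid = z≤n
          ... | hi rewrite in-mid τv = ≤-refl
        finish : Smaller
        finish with suc (#lo (τ ᵒ)) ≤? #lo ρ
        ... | yes strict = τ ᵒ , inj₂ (inj₂ (Good-ᵒ gτ)) , cong flip τr , strict
        ... | no ¬strict = ⊥-elim absurd
          where
          #lo-ρ : #lo ρ ≤ 2
          #lo-ρ = ≤-trans (≤-pred (≰⇒> ¬strict)) #lo-τᵒ
          absurd : ⊥
          absurd with more-lo | more-hiτ
          -- Both vertices of the pair are joined to the whole separator of `ρ`. One of them is `c`
          -- and `d′` lies in that separator, so `c d′` would be a second edge crossing `τ`.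
          ... | z , z≢y , ρz | d′ , d′≢d , τd′ = d′≢d (proj₂ (onlyτ (c~d′ , τc , τd′)))
            where
            1≤ : ∀ {u} → ρ u ≡ lo → 1 ≤ isLo (ρ u)
            1≤ ρu = ≤-reflexive (cong isLo (≡.sym ρu))
            two : ∀ {u} → ρ u ≡ lo → u ≡ y ⊎ u ≡ z
            two {u} ρu with u ≟ y | u ≟ z
            ... | yes eq | _ = inj₁ eq
            ... | no _ | yes eq = inj₂ eq
            ... | no u≢y | no u≢z = ⊥-elim (impossible (≤-trans (unique≤sum {xs = u ∷ y ∷ z ∷ []} (isLo ∘ ρ)
                    ((u≢y ∷ u≢z ∷ []) ∷ ((z≢y ∘ ≡.sym) ∷ []) ∷ [] ∷ []) (1≤ ρu ∷ 1≤ y∈lo ∷ 1≤ ρz ∷ [])) #lo-ρ))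
            joined = proj₂ (lo-pair gρ sy z≢y ρz two) (in-mid τd′)
            c~d′ : c ~ d′
            c~d′ with two ρc
            ... | inj₁ refl = proj₁ joined
            ... | inj₂ refl = proj₂ joined

    -- If `τ` has `r` on its lower side and `d` is on the lower side of `ρ`, then `τ` can be
    -- reversed, with `d` in the role of `c`. With `d` in the separator of `ρ` this is not possible,
    -- hence the separate case `far-lo`.
    uncross : ∀ {ρ τ : Sides n} {y x c d r : Fin n} → Good ρ y x → Good τ c d →
              Sturdy y → Sturdy c → Sturdy d → ρ c ≡ lo → ¬ (c ≡ y × d ≡ x) → ρ r ≡ hi → τ r ≢ mid →
              ∃ λ σ → (Good σ y x ⊎ Good σ c d ⊎ Good σ d c) × σ r ≡ hi × #lo σ < #lo ρ
    uncross {ρ} {τ} {y} {x} {c} {d} {r} gρ gτ sy sc sd ρc distinct ρr τr≢mid with τ r in τr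
    ... | mid = ⊥-elim (τr≢mid refl)
    ... | hi  = Corners.far-hi gρ gτ sy sc ρc distinct ρr τr
    ... | lo with ρ d in ρd
    ...   | mid = Corners.far-lo gρ gτ sy sc ρc distinct ρr τr ρd
    ...   | hi  = ⊥-elim (distinct (Good.only gρ (Good.y~x gτ , ρc , ρd)))
    ...   | lo with Corners.far-hi gρ (Good-ᵒ gτ) sy sd ρd (λ { (_ , refl) → clash ρc (Good.x∈hi gρ) (lo≢hi ∘ ≡.sym) }) ρr (cong flip τr)
    ...     | σ , inj₁ g        , rest = σ , inj₁ g , rest
    ...     | σ , inj₂ (inj₁ g) , rest = σ , inj₂ (inj₂ g) , rest
    ...     | σ , inj₂ (inj₂ g) , rest = σ , inj₂ (inj₁ g) , rest

-- Existence of separations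

∣S∣≡sum : ∀ {n} (S : Subset n) → ∣ S ∣ ≡ sum (λ v → ⟦ lookup S v ⟧)
∣S∣≡sum S = trans (cong ∣_∣ (≡.sym (tabulate∘lookup S))) (∣tabulate∣ (lookup S))

∈─⇒∉ : ∀ {n} {p q : Subset n} {x} → x ∈ˢ p ─ q → x ∉ˢ q
∈─⇒∉ {p = _ ∷ _} {inside ∷ _}  () here
∈─⇒∉ {p = _ ∷ _} {_ ∷ _} (there x∈) (there x∈q) = ∈─⇒∉ x∈ x∈q

∈─⇒∈ : ∀ {n} {p q : Subset n} {x} → x ∈ˢ p ─ q → x ∈ˢ p
∈─⇒∈ {p = _ ∷ _} {outside ∷ _} here = here
∈─⇒∈ {p = _ ∷ _} {_ ∷ _} (there x∈) = there (∈─⇒∈ x∈)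

reach-∈ : ∀ {n} {A : Adjacency n} {W u v} → Reach A W u v → u ∈ˢ W
reach-∈ (here u∈)     = u∈
reach-∈ (step u∈ _ _) = u∈

reach-snoc : ∀ {n} {A : Adjacency n} {W u v w} → Reach A W u v → A v w ≡ true → w ∈ˢ W → Reach A W u w
reach-snoc (here u∈)       e w∈ = step u∈ e (here w∈)
reach-snoc (step u∈ e′ p) e w∈ = step u∈ e′ (reach-snoc p e w∈)

reach-lo : ∀ {n} {A : Adjacency n} {W u v} (ρ : Sides n) →
           (∀ {x} → x ∈ˢ W → ρ x ≢ mid) → (∀ {x y} → A x y ≡ true → ρ x ≡ lo → ρ y ≢ hi) →
           Reach A W u v → ρ u ≡ lo → ρ v ≡ lo
reach-lo ρ avoid closed (here _) ρu = ρu
reach-lo ρ avoid closed (step {w = w} _ e p) ρu = reach-lo ρ avoid closed p ρw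
  where
  ρw : ρ w ≡ lo
  ρw with ρ w in eq
  ... | lo  = refl
  ... | mid = ⊥-elim (avoid (reach-∈ p) eq)
  ... | hi  = ⊥-elim (closed e ρu eq)

Separated : ∀ {n} → Adjacency n → Subset n → Fin n → Fin n → Set
Separated {n} A W u v = ∃ λ (ρ : Sides n) → ρ u ≡ lo × ρ v ≡ hi × (∀ {x} → ρ x ≡ mid → x ∉ˢ W) ×
  (∀ {x} → x ∉ˢ W → ρ x ≡ mid) × (∀ {x y} → A x y ≡ true → ρ x ≡ lo → ρ y ≢ hi)

-- A search from `u`: `hi` marks the vertices reached, and the fuel bounds those still marked `lo`.
-- When the search stops, `place` turns the reached set into the lower side and puts everything
-- outside `W` into the separator.
reach⊎separated : ∀ {n} (A : Adjacency n) W u v → u ∈ˢ W → v ∈ˢ W → Reach A W u v ⊎ Separated A W u v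
reach⊎separated {n} A W u v u∈ v∈ =
  grow n start (≤-trans (sum-mono isLo≤1) (≤-reflexive (sum-one n))) (≔-same _ u hi) reached-start start≢mid
  where
  start : Sides n
  start = (λ _ → lo) [ u ]≔ hi
  isLo≤1 : ∀ w → isLo (start w) ≤ 1
  isLo≤1 w with start w
  ... | lo  = ≤-refl
  ... | mid = z≤n
  ... | hi  = z≤n
  start≢mid : ∀ {a} → start a ≢ mid
  start≢mid a∈ with ≔-inv _ u hi a∈
  ... | inj₁ (_ , ())
  ... | inj₂ (_ , ())
  reached-start : ∀ {a} → start a ≡ hi → Reach A W u a
  reached-start a∈ with ≔-inv _ u hi a∈
  ... | inj₁ (refl , _) = here u∈
  ... | inj₂ (_ , ())
  place : ∀ {w} → Dec (w ∈ˢ W) → Side → Side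
  place (no _)  s  = mid
  place (yes _) hi = lo
  place (yes _) s  = hi
  place-lo : ∀ {w s} (d : Dec (w ∈ˢ W)) → place d s ≡ lo → s ≡ hi
  place-lo {s = hi}  (yes _) _ = refl
  place-lo {s = lo}  (yes _) ()
  place-lo {s = mid} (yes _) ()
  place-hi : ∀ {w s} (d : Dec (w ∈ˢ W)) → place d s ≡ hi → w ∈ˢ W × s ≢ hi
  place-hi {s = lo}  (yes w∈) _ = w∈ , λ ()
  place-hi {s = mid} (yes w∈) _ = w∈ , λ ()
  place-hi {s = hi}  (yes _) ()
  place-mid : ∀ {w s} (d : Dec (w ∈ˢ W)) → place d s ≡ mid → w ∉ˢ W
  place-mid (no w∉) _ = w∉
  place-mid {s = lo}  (yes _) ()
  place-mid {s = mid} (yes _) ()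
  place-mid {s = hi}  (yes _) ()
  place-∉ : ∀ {w s} (d : Dec (w ∈ˢ W)) → w ∉ˢ W → place d s ≡ mid
  place-∉ (no _)   w∉ = refl
  place-∉ (yes w∈) w∉ = ⊥-elim (w∉ w∈)
  place-yes : ∀ {w} (d : Dec (w ∈ˢ W)) → w ∈ˢ W → place d hi ≡ lo
  place-yes (yes _) _ = refl
  place-yes (no w∉) w∈ = ⊥-elim (w∉ w∈)
  place-yes′ : ∀ {w s} (d : Dec (w ∈ˢ W)) → w ∈ˢ W → s ≢ hi → place d s ≡ hi
  place-yes′ {s = lo}  (yes _) _ _ = refl
  place-yes′ {s = mid} (yes _) _ _ = refl
  place-yes′ {s = hi}  (yes _) _ s≢hi = ⊥-elim (s≢hi refl)
  place-yes′ (no w∉) w∈ = ⊥-elim (w∉ w∈)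
  grow : ∀ k (ζ : Sides n) → #lo ζ ≤ k → ζ u ≡ hi → (∀ {a} → ζ a ≡ hi → Reach A W u a) →
         (∀ {a} → ζ a ≢ mid) → Reach A W u v ⊎ Separated A W u v
  grow k ζ bound ζu reached ζ≢mid
    with any? (λ a → any? (λ b → (ζ a ≟ˢ hi) ×-dec (ζ b ≟ˢ lo) ×-dec (b ∈? W) ×-dec (A a b Bool.≟ true)))
  grow zero ζ bound ζu reached ζ≢mid | yes (a , b , ζa , ζb , b∈ , e) =
    ⊥-elim (impossible (≤-trans (unique≤sum {xs = b ∷ []} (isLo ∘ ζ) ([] ∷ []) (≤-reflexive (cong isLo (≡.sym ζb)) ∷ [])) bound))
  grow (suc k) ζ bound ζu reached ζ≢mid | yes (a , b , ζa , ζb , b∈ , e) =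
    grow k ζ′ (≤-pred (≤-trans (#lo-strict b strict ζb) bound)) ζ′u reached′ ζ′≢mid
    where
    ζ′ : Sides n
    ζ′ = ζ [ b ]≔ hi
    strict : ∀ w → ζ′ w ≡ lo → ζ w ≡ lo × w ≢ b
    strict w ζ′w with ≔-inv ζ b hi ζ′w
    ... | inj₂ (b≢w , ζw) = ζw , b≢w ∘ ≡.sym
    ... | inj₁ (_ , ())
    ζ′u : ζ′ u ≡ hi
    ζ′u with b ≟ u
    ... | yes _ = refl
    ... | no _  = ζu
    ζ′≢mid : ∀ {w} → ζ′ w ≢ mid
    ζ′≢mid ζ′w with ≔-inv ζ b hi ζ′w
    ... | inj₂ (_ , ζw) = ζ≢mid ζw
    ... | inj₁ (_ , ())
    reached′ : ∀ {w} → ζ′ w ≡ hi → Reach A W u w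
    reached′ ζ′w with ≔-inv ζ b hi ζ′w
    ... | inj₁ (refl , _) = reach-snoc (reached ζa) e b∈
    ... | inj₂ (_ , ζw) = reached ζw
  grow k ζ bound ζu reached ζ≢mid | no stuck with ζ v ≟ˢ hi
  ... | yes ζv = inj₁ (reached ζv)
  ... | no ζv≢hi = inj₂ (ρ , trans (cong (place (u ∈? W)) ζu) (place-yes (u ∈? W) u∈) , place-yes′ (v ∈? W) v∈ ζv≢hi
                        , (λ {x} → place-mid (x ∈? W)) , (λ {x} → place-∉ (x ∈? W)) , λ {x} {y} → closed {x} {y})
    where
    ρ : Sides n
    ρ x = place (x ∈? W) (ζ x)
    closed : ∀ {x y} → A x y ≡ true → ρ x ≡ lo → ρ y ≢ hi
    closed {x} {y} e ρx ρy with place-hi (y ∈? W) ρy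
    ... | y∈ , ζy≢hi with ζ y in ζy
    ...   | lo  = stuck (x , y , place-lo (x ∈? W) ρx , ζy , y∈ , e)
    ...   | hi  = ζy≢hi refl
    ...   | mid = ζ≢mid ζy

deleteEdge-inv : ∀ {n} (A : Adjacency n) a b {u w} → A u w ≡ true →
                 deleteEdge A a b u w ≡ true ⊎ (u ≡ a × w ≡ b) ⊎ (u ≡ b × w ≡ a)
deleteEdge-inv A a b {u} {w} e rewrite e with u ≟ a | w ≟ b | u ≟ b | w ≟ a
... | yes p | yes q | _     | _     = inj₂ (inj₁ (p , q))
... | yes _ | no _  | yes p | yes q = inj₂ (inj₂ (p , q))
... | no _  | yes _ | yes p | yes q = inj₂ (inj₂ (p , q))
... | no _  | no _  | yes p | yes q = inj₂ (inj₂ (p , q))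
... | yes _ | no _  | yes _ | no _  = inj₁ refl
... | yes _ | no _  | no _  | yes _ = inj₁ refl
... | yes _ | no _  | no _  | no _  = inj₁ refl
... | no _  | yes _ | yes _ | no _  = inj₁ refl
... | no _  | yes _ | no _  | yes _ = inj₁ refl
... | no _  | yes _ | no _  | no _  = inj₁ refl
... | no _  | no _  | yes _ | no _  = inj₁ refl
... | no _  | no _  | no _  | yes _ = inj₁ refl
... | no _  | no _  | no _  | no _  = inj₁ refl

-- The weight `g` pays for the vertices outside `W`, which all count as separating: nothing for a
-- deleted edge, one for a deleted vertex. A negated universal statement yields the separation only
-- up to double negation, which suffices because every use aims at `⊥`.
¬KConnected⇒separated : ∀ {n} (A : Adjacency n) W (g : Fin n → ℕ) → (∀ {x} → x ∉ˢ W → 1 ≤ g x) →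
  3 < ∣ W ∣ → ¬ KConnectedOn 3 A W →
  ¬ (∀ (ρ : Sides n) {l r} → ρ l ≡ lo → ρ r ≡ hi → #mid ρ ≤ 2 + sum g →
       (∀ {x} → x ∉ˢ W → ρ x ≡ mid) → (∀ {x y} → A x y ≡ true → ρ x ≡ lo → ρ y ≢ hi) → ⊥)
¬KConnected⇒separated {n} A W g outside≥1 3<W ¬conn none = ¬conn (3<W , connected)
  where
  connected : ∀ S → S ⊆ W → ∣ S ∣ < 3 → ConnectedOn A (W ─ S)
  connected S S⊆W S<3 u v u∈ v∈ with reach⊎separated A (W ─ S) u v u∈ v∈
  ... | inj₁ path = path
  ... | inj₂ (ρ , ρu , ρv , mid⇒∉ , ∉⇒mid , closed) =
    ⊥-elim (none ρ ρu ρv small (λ x∉ → ∉⇒mid (x∉ ∘ ∈─⇒∈)) closed)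
    where
    pointwise : ∀ x → isMid (ρ x) ≤ ⟦ lookup S x ⟧ + g x
    pointwise x with ρ x in ρx
    ... | lo  = z≤n
    ... | hi  = z≤n
    ... | mid with x ∈? W | x ∈? S
    ...   | no x∉ | _ = ≤-trans (outside≥1 x∉) (m≤n+m _ _)
    ...   | yes _ | yes x∈S = ≤-trans (≤-reflexive (cong ⟦_⟧ (≡.sym ([]=⇒lookup x∈S)))) (m≤m+n _ _)
    ...   | yes x∈ | no x∉S = ⊥-elim (mid⇒∉ ρx (x∈p∧x∉q⇒x∈p─q x∈ x∉S))
    small : #mid ρ ≤ 2 + sum g
    small = ≤-trans (sum-mono pointwise) (≤-trans (≤-reflexive (trans (∑-distrib-+ (λ x → ⟦ lookup S x ⟧) g)
              (cong (_+ sum g) (≡.sym (∣S∣≡sum S))))) (+-monoˡ-≤ (sum g) (≤-pred S<3)))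

-- Separations obtained from minimality and criticality

module _ {n : ℕ} (G : Graph n) where
  open Separations G

  degree≡deg : ∀ v → degree G v ≡ deg v
  degree≡deg v = ∣tabulate∣ (adj G v)

  deg<n : ∀ v → deg v < n
  deg<n v = ≤-trans (≤-reflexive (≡.sym (trans (∑-distrib-+ (δ v) (λ w → ⟦ adj G v w ⟧)) (cong (_+ deg v) (sum-δ v)))))
              (≤-trans (sum-mono pointwise) (≤-reflexive (sum-one n)))
    where
    pointwise : ∀ w → δ v w + ⟦ adj G v w ⟧ ≤ 1
    pointwise w with v ≟ w
    ... | yes refl rewrite irrefl G v = ≤-refl
    ... | no _ with adj G v w
    ...   | true  = ≤-refl
    ...   | false = z≤n

  module Three (three : ThreeConnected G) where

    3<n : 3 < n
    3<n = ≤-trans (proj₁ three) (≤-reflexive (∣⊤∣≡n n))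

    connected : ∀ {ρ : Sides n} {l r} → Uncrossed ρ → ρ l ≡ lo → ρ r ≡ hi → #mid ρ ≤ 2 → ⊥
    connected {ρ} {l} {r} un ρl ρr small = clash (reach-lo ρ avoid (λ e ρx ρy → un (e , ρx , ρy)) path ρl) ρr (lo≢hi ∘ ≡.sym)
      where
      isMid? : Side → Bool
      isMid? mid = true
      isMid? _   = false
      S : Subset n
      S = tabulate (isMid? ∘ ρ)
      size : ∣ S ∣ ≤ 2
      size = ≤-trans (≤-reflexive (trans (∣tabulate∣ (isMid? ∘ ρ)) (sum-cong-≗ λ v → same (ρ v)))) small
        where
        same : ∀ s → ⟦ isMid? s ⟧ ≡ isMid s
        same lo  = refl
        same mid = refl
        same hi  = refl
      S-lookup : ∀ v → lookup S v ≡ isMid? (ρ v)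
      S-lookup = lookup∘tabulate (isMid? ∘ ρ)
      ∉S : ∀ {v} → isMid? (ρ v) ≡ false → v ∈ˢ ⊤ ─ S
      ∉S {v} ρv = x∈p∧x∉q⇒x∈p─q ∈⊤ λ v∈ → case trans (≡.sym ([]=⇒lookup v∈)) (trans (S-lookup v) ρv) of λ ()
      avoid : ∀ {x} → x ∈ˢ ⊤ ─ S → ρ x ≢ mid
      avoid {x} x∈ ρx = ∈─⇒∉ x∈ (lookup⇒[]= x S (trans (S-lookup x) (cong isMid? ρx)))
      path : Reach (adj G) (⊤ ─ S) l r
      path = proj₂ three S ⊆⊤ (s≤s size) l r (∉S (cong isMid? ρl)) (∉S (cong isMid? ρr))

    -- Two neighbours would separate `v` from the other vertices; if there are no others, the graph
    -- has at most three vertices.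
    deg≥3 : ∀ v → 3 ≤ deg v
    deg≥3 v with 3 ≤? deg v
    ... | yes p = p
    ... | no ¬p = ⊥-elim (impossible (≤-trans 3<n n≤3))
      where
      deg≤2 : deg v ≤ 2
      deg≤2 = ≤-pred (≰⇒> ¬p)
      side : Bool → Side
      side true  = mid
      side false = hi
      nbrs : Sides n
      nbrs w = side (adj G v w)
      ρ : Sides n
      ρ = nbrs [ v ]≔ lo
      mids : ∀ b → isMid (side b) ≡ ⟦ b ⟧
      mids true  = refl
      mids false = refl
      #ρ≤ : #mid ρ ≤ 2
      #ρ≤ = ≤-trans (sum-mono pointwise) deg≤2
        where
        pointwise : ∀ w → isMid (ρ w) ≤ ⟦ adj G v w ⟧
        pointwise w with v ≟ w
        ... | yes _ = z≤n
        ... | no _  = ≤-reflexive (mids (adj G v w))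
      un : Uncrossed ρ
      un {u} {w} (u~w , ρu , ρw) with ≔-inv nbrs v lo ρu | ≔-inv nbrs v lo ρw
      ... | _ | inj₁ (_ , ())
      ... | inj₁ (refl , _) | inj₂ (_ , Nw) rewrite u~w = case Nw of λ ()
      ... | inj₂ (_ , Nu) | inj₂ _ with adj G v u
      ...   | true  = case Nu of λ ()
      ...   | false = case Nu of λ ()
      n≤3 : n ≤ 3
      n≤3 = ≤-trans (≤-reflexive (≡.sym (sum-one n))) (≤-trans (sum-mono pointwise)
              (≤-trans (≤-reflexive (trans (∑-distrib-+ (δ v) (λ w → ⟦ adj G v w ⟧)) (cong (_+ deg v) (sum-δ v)))) (s≤s deg≤2)))
        where
        pointwise : ∀ w → 1 ≤ δ v w + ⟦ adj G v w ⟧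
        pointwise w with ρ w in ρw
        ... | hi = ⊥-elim (connected {ρ} un (≔-same nbrs v lo) ρw #ρ≤)
        ... | lo with ≔-inv nbrs v lo ρw
        ...   | inj₁ (refl , _) = ≤-trans (≤-reflexive (≡.sym (δ-refl v))) (m≤m+n _ _)
        ...   | inj₂ (_ , Nw) with adj G v w
        ...     | true  = case Nw of λ ()
        ...     | false = case Nw of λ ()
        pointwise w | mid with ≔-inv nbrs v lo ρw
        ...   | inj₁ (_ , ())
        ...   | inj₂ (_ , Nw) with adj G v w
        ...     | true  = m≤n+m 1 _
        ...     | false = case Nw of λ ()

    open Connected connected deg≥3 public
    open Uncross G connected deg≥3 public

    lo-more : ∀ {ρ : Sides n} {y x} → Sep ρ y x → 4 ≤ deg y → ∃ λ u → u ≢ y × ρ u ≡ lo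
    lo-more {ρ} {y} {x} (mkSep y~x y∈ x∈ only small) 4≤ with lo-other? ρ y
    ... | yes p = p
    ... | no ¬p = ⊥-elim (impossible (≤-trans 4≤ (≤-trans (deg≤ ρ (x ∷ []) near) (+-monoˡ-≤ 1 small))))
      where
      near : ∀ {w} → y ~ w → ρ w ≡ mid ⊎ w ∈ x ∷ []
      near {w} y~w with ρ w in ρw
      ... | mid = inj₁ refl
      ... | hi  = inj₂ (here (proj₂ (only (y~w , y∈ , ρw))))
      ... | lo  = ⊥-elim (¬p (w , (~⇒≢ y~w ∘ ≡.sym) , ρw))

    hi-more : ∀ {ρ : Sides n} {y x} → Sep ρ y x → 4 ≤ deg x → ∃ λ w → w ≢ x × ρ w ≡ hi
    hi-more sep 4≤ = let w , w≢ , w∈ = lo-more (Sep-ᵒ sep) 4≤ in w , w≢ , flip-lo w∈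

    -- A separation of the graph without `c d` must be crossed by `c d`, or it would disconnect the
    -- graph itself; it is reversed if `d` is the lower end. The degrees provide the second vertex
    -- on each side.
    good-edge : ∀ {c d} → ¬ KConnectedOn 3 (deleteEdge (adj G) c d) ⊤ → c ~ d → 4 ≤ deg c → 4 ≤ deg d →
                ¬ (∀ (ρ : Sides n) → ¬ Good ρ c d)
    good-edge {c} {d} ¬conn c~d 4≤c 4≤d none =
      ¬KConnected⇒separated (deleteEdge (adj G) c d) ⊤ (λ _ → 0) (λ x∉ → ⊥-elim (x∉ ∈⊤))
        (proj₁ three) ¬conn found
      where
      found : ∀ (ρ : Sides n) {l r} → ρ l ≡ lo → ρ r ≡ hi → #mid ρ ≤ 2 + sum {n} (λ _ → 0) →
              (∀ {x} → x ∉ˢ ⊤ → ρ x ≡ mid) →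
              (∀ {x y} → deleteEdge (adj G) c d x y ≡ true → ρ x ≡ lo → ρ y ≢ hi) → ⊥
      found ρ ρl ρr small′ _ closed = connected {ρ} un ρl ρr small
        where
        small : #mid ρ ≤ 2
        small = ≤-trans small′ (≤-reflexive (cong (2 +_) (sum-zero {n} {λ _ → 0} λ _ → refl)))
        crossing : ∀ {u w} → Cross ρ u w → (u ≡ c × w ≡ d) ⊎ (u ≡ d × w ≡ c)
        crossing (e , ρu , ρw) with deleteEdge-inv (adj G) c d e
        ... | inj₁ e′  = ⊥-elim (closed e′ ρu ρw)
        ... | inj₂ eqs = eqs
        good : ∀ {σ : Sides n} → σ c ≡ lo → σ d ≡ hi → Only σ c d → #mid σ ≤ 2 → Good σ c d
        good σc σd only small = mkGood sep (lo-more sep 4≤c) (hi-more sep 4≤d)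
          where sep = mkSep c~d σc σd only small
        un : Uncrossed ρ
        un cr@(e , ρu , ρw) with crossing cr
        ... | inj₁ (refl , refl) = none ρ (good ρu ρw only small)
          where
          only : Only ρ c d
          only cr′ with crossing cr′
          ... | inj₁ eqs = eqs
          ... | inj₂ (refl , _) = clash (proj₁ (proj₂ cr′)) ρw (lo≢hi ∘ ≡.sym)
        ... | inj₂ (refl , refl) = none (ρ ᵒ) (good (cong flip ρw) (cong flip ρu) (Only-ᵒ {ρ} only)
                                       (≤-trans (≤-reflexive (#mid-ᵒ ρ)) small))
          where
          only : Only ρ d c
          only cr′ with crossing cr′
          ... | inj₁ (refl , _) = clash (proj₁ (proj₂ cr′)) ρw (lo≢hi ∘ ≡.sym)
          ... | inj₂ eqs = eqs

    -- The separator consists of `y` and at most two more vertices, and `y` has at most one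
    -- neighbour on one side. The degrees of the neighbours are used twice: deleting `y` leaves more
    -- than three vertices, so it is connectivity that fails, and the upper end of the new edge is
    -- not alone on its side.
    good-at : ∀ {y} → ¬ KConnectedOn 3 (adj G) (⊤ - y) → deg y ≤ 3 → (∀ {w} → y ~ w → 4 ≤ deg w) →
              ¬ (∀ {d} (ρ : Sides n) → ¬ Good ρ y d)
    good-at {y} ¬conn deg-y nbrs none =
      ¬KConnected⇒separated (adj G) (⊤ - y) (δ y) outside≥1 3<W ¬conn found
      where
      outside≥1 : ∀ {x} → x ∉ˢ ⊤ - y → 1 ≤ δ y x
      outside≥1 {x} x∉ with x ≟ y
      ... | yes refl = ≤-reflexive (≡.sym (δ-refl y))
      ... | no x≢y   = ⊥-elim (x∉ (x∈p∧x≢y⇒x∈p-y ∈⊤ x≢y))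
      some-nbr : ∃ λ w → y ~ w
      some-nbr with any? (y ~?_)
      ... | yes p = p
      ... | no ¬p = ⊥-elim (impossible (≤-trans (deg≥3 y) (≤-trans (deg≤ (λ _ → lo) [] λ y~w → ⊥-elim (¬p (_ , y~w)))
                      (≤-reflexive (trans (+-identityʳ _) (sum-zero {n} {λ _ → 0} λ _ → refl))))))
      3<W : 3 < ∣ ⊤ - y ∣
      3<W = ≤-pred (≤-trans (≤-trans (s≤s (nbrs (proj₂ some-nbr))) (deg<n (proj₁ some-nbr)))
              (≤-trans (≤-reflexive (≡.sym (sum-one n))) (≤-trans (sum-mono pointwise)
              (≤-reflexive (trans (∑-distrib-+ (δ y) (λ v → ⟦ lookup (⊤ - y) v ⟧))
                (cong₂ _+_ (sum-δ y) (≡.sym (∣S∣≡sum (⊤ - y)))))))))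
        where
        pointwise : ∀ v → 1 ≤ δ y v + ⟦ lookup (⊤ - y) v ⟧
        pointwise v with v ∈? ⊤ - y
        ... | yes v∈ = ≤-trans (≤-reflexive (cong ⟦_⟧ (≡.sym ([]=⇒lookup v∈)))) (m≤n+m _ _)
        ... | no v∉  = ≤-trans (outside≥1 v∉) (m≤m+n _ _)
      -- With a single neighbour u of y above, y joins the lower side and yu becomes the crossing edge.
      unique⇒⊥ : ∀ (ρ : Sides n) {l r} → Uncrossed ρ → ρ l ≡ lo → ρ r ≡ hi → #mid ρ ≤ 3 → ρ y ≡ mid →
                 (∀ {u w} → y ~ u → y ~ w → ρ u ≡ hi → ρ w ≡ hi → u ≡ w) → ⊥
      unique⇒⊥ ρ {l} {r} un ρl ρr small ρy unique with any? (λ u → (y ~? u) ×-dec (ρ u ≟ˢ hi))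
      ... | no ¬u = connected {ρ [ y ]≔ lo} un′ (at lo≢mid ρl) (at (mid≢hi ∘ ≡.sym) ρr) small′
        where
        at : ∀ {w s} → s ≢ mid → ρ w ≡ s → (ρ [ y ]≔ lo) w ≡ s
        at s≢ ρw = trans (≔-other ρ {y} lo λ { refl → s≢ (trans (≡.sym ρw) ρy) }) ρw
        small′ : #mid (ρ [ y ]≔ lo) ≤ 2
        small′ = ≤-pred (≤-trans (#mid-shrink ρ y lo ρy refl) small)
        un′ : Uncrossed (ρ [ y ]≔ lo)
        un′ (e , u∈ , w∈) with ≔-inv ρ y lo u∈ | ≔-inv ρ y lo w∈
        ... | _ | inj₁ (_ , ())
        ... | inj₁ (refl , _) | inj₂ (_ , ρw) = ¬u (_ , e , ρw)
        ... | inj₂ (_ , ρu) | inj₂ (_ , ρw) = un (e , ρu , ρw)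
      ... | yes (u , y~u , ρu) = none (ρ [ y ]≔ lo) (mkGood sep (l , l≢y , at lo≢mid ρl) (hi-more sep (nbrs y~u)))
        where
        at : ∀ {w s} → s ≢ mid → ρ w ≡ s → (ρ [ y ]≔ lo) w ≡ s
        at s≢ ρw = trans (≔-other ρ {y} lo λ { refl → s≢ (trans (≡.sym ρw) ρy) }) ρw
        l≢y : l ≢ y
        l≢y refl = clash ρl ρy (lo≢mid ∘ ≡.sym)
        only : Only (ρ [ y ]≔ lo) y u
        only (e , a∈ , b∈) with ≔-inv ρ y lo a∈ | ≔-inv ρ y lo b∈
        ... | _ | inj₁ (_ , ())
        ... | inj₁ (refl , _) | inj₂ (_ , ρb) = refl , unique e y~u ρb ρu
        ... | inj₂ (_ , ρa) | inj₂ (_ , ρb) = ⊥-elim (un (e , ρa , ρb))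
        sep : Sep (ρ [ y ]≔ lo) y u
        sep = mkSep y~u (≔-same ρ y lo) (at (mid≢hi ∘ ≡.sym) ρu) only
                (≤-pred (≤-trans (#mid-shrink ρ y lo ρy refl) small))
      found : ∀ (ρ : Sides n) {l r} → ρ l ≡ lo → ρ r ≡ hi → #mid ρ ≤ 2 + sum (δ y) →
              (∀ {x} → x ∉ˢ ⊤ - y → ρ x ≡ mid) →
              (∀ {a b} → adj G a b ≡ true → ρ a ≡ lo → ρ b ≢ hi) → ⊥
      found ρ {l} {r} ρl ρr small′ mids closed = split
        where
        small : #mid ρ ≤ 3
        small = ≤-trans small′ (≤-reflexive (cong (2 +_) (sum-δ y)))
        ρy : ρ y ≡ mid
        ρy = mids λ y∈ → ∈─⇒∉ y∈ (x∈⁅x⁆ y)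
        un : Uncrossed ρ
        un (e , ρu , ρw) = closed e ρu ρw
        split : ⊥
        split with unique-side {ρ} deg-y
        ... | inj₁ unique = unique⇒⊥ ρ un ρl ρr small ρy unique
        ... | inj₂ unique = unique⇒⊥ (ρ ᵒ) (un ∘ Cross-ᵒ {ρ}) (cong flip ρr) (cong flip ρl)
                              (≤-trans (≤-reflexive (#mid-ᵒ ρ)) small) (cong flip ρy)
                              (λ e e′ a∈ b∈ → unique e e′ (flip-hi a∈) (flip-hi b∈))

-- The potential

infixl 6 _⊞_

_⊞_ : ∀ {n} → (Fin n → ℕ) → (Fin n → ℕ) → Fin n → ℕ
(f ⊞ g) v = f v + g v

member : {P : Set} → Dec P → ℕ
member P? = ⟦ does P? ⟧

member-yes : {P : Set} (P? : Dec P) → P → 1 ≤ member P?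
member-yes (yes _) _ = ≤-refl
member-yes (no ¬p) p = ⊥-elim (¬p p)

member-case : {P : Set} (P? : Dec P) → member P? ≡ 0 ⊎ (member P? ≡ 1 × P)
member-case (yes p) = inj₂ (refl , p)
member-case (no _)  = inj₁ refl

module Potential {n : ℕ} (G : Graph n) where
  open Separations G

  cost : Fin n → ℕ
  cost v with deg v ≤? 3
  ... | yes _ = 1
  ... | no _  = deg v + 2

  cost-cubic : ∀ {v} → deg v ≤ 3 → cost v ≡ 1
  cost-cubic {v} ≤3 with deg v ≤? 3
  ... | yes _ = refl
  ... | no ≰3 = ⊥-elim (≰3 ≤3)

  cost-big : ∀ {v} → 4 ≤ deg v → cost v ≡ deg v + 2
  cost-big {v} 4≤ with deg v ≤? 3
  ... | yes ≤3 = ⊥-elim (impossible (≤-trans 4≤ ≤3))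
  ... | no _   = refl

  d : (Fin n → ℕ) → Fin n → ℕ
  d f u = sum (λ w → ⟦ adj G u w ⟧ * f w)

  -- Ordered pairs are counted, so `e M M` is twice the number of edges inside M and ψ(M) is `e M M`
  -- minus `total M`. Sets are numerical functions to make these expressions additive, and ψ(M) ≥ 0
  -- is written `total M ≤ e M M` to avoid subtraction.
  e : (Fin n → ℕ) → (Fin n → ℕ) → ℕ
  e f g = sum (λ u → f u * d g u)

  total : (Fin n → ℕ) → ℕ
  total f = sum (λ v → cost v * f v)

  d-⊞ : ∀ f g u → d (f ⊞ g) u ≡ d f u + d g u
  d-⊞ f g u = trans (sum-cong-≗ λ w → *-distribˡ-+ ⟦ adj G u w ⟧ (f w) (g w))
                    (∑-distrib-+ (λ w → ⟦ adj G u w ⟧ * f w) (λ w → ⟦ adj G u w ⟧ * g w))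

  e-⊞ʳ : ∀ f g h → e f (g ⊞ h) ≡ e f g + e f h
  e-⊞ʳ f g h = trans (sum-cong-≗ λ u → trans (cong (f u *_) (d-⊞ g h u)) (*-distribˡ-+ (f u) (d g u) (d h u)))
                     (∑-distrib-+ (λ u → f u * d g u) (λ u → f u * d h u))

  e-⊞ˡ : ∀ f g h → e (f ⊞ g) h ≡ e f h + e g h
  e-⊞ˡ f g h = trans (sum-cong-≗ λ u → *-distribʳ-+ (d h u) (f u) (g u))
                     (∑-distrib-+ (λ u → f u * d h u) (λ u → g u * d h u))

  e-sym : ∀ f g → e f g ≡ e g f
  e-sym f g = begin
    sum (λ u → f u * d g u)                              ≡⟨ sum-cong-≗ (λ u → ≡.sym (sum-*ˡ (f u) (λ w → ⟦ adj G u w ⟧ * g w))) ⟩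
    sum (λ u → sum (λ w → f u * (⟦ adj G u w ⟧ * g w)))  ≡⟨ ∑-comm (λ u w → f u * (⟦ adj G u w ⟧ * g w)) ⟩
    sum (λ w → sum (λ u → f u * (⟦ adj G u w ⟧ * g w)))  ≡⟨ sum-cong-≗ (λ w → sum-cong-≗ λ u → swap u w) ⟩
    sum (λ w → sum (λ u → g w * (⟦ adj G w u ⟧ * f u)))  ≡⟨ sum-cong-≗ (λ w → sum-*ˡ (g w) (λ u → ⟦ adj G w u ⟧ * f u)) ⟩
    sum (λ w → g w * d f w)                              ∎
    where
    open ≡-Reasoning
    swap : ∀ u w → f u * (⟦ adj G u w ⟧ * g w) ≡ g w * (⟦ adj G w u ⟧ * f u)
    swap u w rewrite Graph.sym G u w =
      solve 3 (λ x y z → x :* (y :* z) := z :* (y :* x)) refl (f u) ⟦ adj G w u ⟧ (g w)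

  e-δ : ∀ a g → e (δ a) g ≡ d g a
  e-δ a g = sum-pick a (d g)

  -- Shows that absorbing `g` into `f` changes ψ by `2 * e g f + e g g` minus `total g`.
  e-square : ∀ f g → e (f ⊞ g) (f ⊞ g) ≡ e f f + (2 * e g f + e g g)
  e-square f g = begin
    e (f ⊞ g) (f ⊞ g)                        ≡⟨ e-⊞ˡ f g (f ⊞ g) ⟩
    e f (f ⊞ g) + e g (f ⊞ g)                ≡⟨ cong₂ _+_ (e-⊞ʳ f f g) (e-⊞ʳ g f g) ⟩
    (e f f + e f g) + (e g f + e g g)        ≡⟨ cong (λ k → (e f f + k) + (e g f + e g g)) (e-sym f g) ⟩
    (e f f + e g f) + (e g f + e g g)        ≡⟨ solve 3 (λ x y z → (x :+ y) :+ (y :+ z) := x :+ (con 2 :* y :+ z)) refl (e f f) (e g f) (e g g) ⟩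
    e f f + (2 * e g f + e g g)              ∎
    where
    open ≡-Reasoning

  total-⊞ : ∀ f g → total (f ⊞ g) ≡ total f + total g
  total-⊞ f g = trans (sum-cong-≗ λ v → *-distribˡ-+ (cost v) (f v) (g v))
                      (∑-distrib-+ (λ v → cost v * f v) (λ v → cost v * g v))

  total-δ : ∀ a → total (δ a) ≡ cost a
  total-δ a = trans (sum-cong-≗ λ v → *-comm (cost v) (δ a v)) (sum-pick a cost)

  d-δ≥ : ∀ {f u w} → u ~ w → 1 ≤ f w → 1 ≤ d f u
  d-δ≥ {f} {u} {w} u~w 1≤ = unique≤sum {xs = w ∷ []} (λ v → ⟦ adj G u v ⟧ * f v) ([] ∷ [])
    (≤-trans 1≤ (≤-reflexive (≡.sym (trans (cong (λ b → ⟦ b ⟧ * f w) u~w) (+-identityʳ (f w))))) ∷ [])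

  deg-split : ∀ {u} f g → (∀ {w} → u ~ w → 1 ≤ f w + g w) → deg u ≤ d f u + sum g
  deg-split {u} f g cover = ≤-trans (sum-mono pointwise)
    (≤-reflexive (∑-distrib-+ (λ w → ⟦ adj G u w ⟧ * f w) g))
    where
    pointwise : ∀ w → ⟦ adj G u w ⟧ ≤ ⟦ adj G u w ⟧ * f w + g w
    pointwise w with adj G u w in eq
    ... | false = z≤n
    ... | true rewrite +-identityʳ (f w) = cover eq

  -- M is absorbed and v₀ removed; what is left cannot be absorbed without loss.
  module Stuck {v₀ : Fin n} {M : Fin n → ℕ}
    (bounded : ∀ v → M v + δ v₀ v ≤ 1)
    (stuck : ∀ A → (∀ v → A v + (M v + δ v₀ v) ≤ 1) → 1 ≤ sum A → ¬ total A ≤ 2 * e A M + e A A)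
    where

    Left : Fin n → Set
    Left u = M u ≡ 0 × u ≢ v₀

    left? : ∀ u → Dec (Left u)
    left? u = (M u ℕ.≟ 0) ×-dec ¬? (u ≟ v₀)

    left-room : ∀ {u} → Left u → M u + δ v₀ u ≡ 0
    left-room (Mu , u≢v₀) = cong₂ _+_ Mu (δ-≢ (u≢v₀ ∘ ≡.sym))

    room : ∀ (A : Fin n → ℕ) → (∀ v → A v ≡ 0 ⊎ (A v ≤ 1 × Left v)) → ∀ v → A v + (M v + δ v₀ v) ≤ 1
    room A ok v with ok v
    ... | inj₁ Av rewrite Av = bounded v
    ... | inj₂ (Av , left) rewrite left-room left | +-identityʳ (A v) = Av

    M≥1 : ∀ {w} → M w ≢ 0 → 1 ≤ M w
    M≥1 {w} M≢0 with M w
    ... | zero  = ⊥-elim (M≢0 refl)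
    ... | suc _ = s≤s z≤n

    single : ∀ {w} → Left w → ¬ cost w ≤ 2 * d M w
    single {w} left cheap = stuck (δ w) (room (δ w) ok) (≤-reflexive (≡.sym (sum-δ w)))
      (≤-trans (≤-reflexive (total-δ w)) (≤-trans cheap (≤-trans
        (≤-reflexive (cong (2 *_) (≡.sym (e-δ w M)))) (m≤m+n _ _))))
      where
      ok : ∀ v → δ w v ≡ 0 ⊎ (δ w v ≤ 1 × Left v)
      ok v with w ≟ v
      ... | yes refl = inj₂ (≤-refl , left)
      ... | no _     = inj₁ refl

    -- One edge into M contributes 2 and the vertex costs only 1.
    cubic-nbr : ∀ {w u} → Left w → deg w ≤ 3 → w ~ u → M u ≡ 0
    cubic-nbr {w} {u} left ≤3 w~u with M u ℕ.≟ 0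
    ... | yes p = p
    ... | no M≢0 = ⊥-elim (single left (≤-trans (≤-reflexive (cost-cubic ≤3))
                     (≤-trans (d-δ≥ {M} w~u (M≥1 M≢0)) (m≤m+n _ _))))

    -- Absorbed together, the two vertices cost 2, which the edge between them, counted twice,
    -- repays.
    cubic-indep : ∀ {w u} → Left w → Left u → deg w ≤ 3 → deg u ≤ 3 → ¬ w ~ u
    cubic-indep {w} {u} lw lu w≤3 u≤3 w~u = stuck A (room A ok) (≤-trans (m≤m+n 1 _)
        (≤-reflexive (≡.sym (trans (∑-distrib-+ (δ w) (δ u)) (cong₂ _+_ (sum-δ w) (sum-δ u))))))
      (≤-trans (≤-reflexive (trans (total-⊞ (δ w) (δ u)) (cong₂ _+_ (trans (total-δ w) (cost-cubic w≤3)) (trans (total-δ u) (cost-cubic u≤3)))))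
        (≤-trans (≤-trans (+-mono-≤ (d-δ≥ {A} w~u 1≤Au) (d-δ≥ {A} (~-sym w~u) 1≤Aw))
          (≤-reflexive (≡.sym (trans (e-⊞ˡ (δ w) (δ u) A) (cong₂ _+_ (e-δ w A) (e-δ u A)))))) (m≤n+m _ _)))
      where
      A : Fin n → ℕ
      A = δ w ⊞ δ u
      1≤Aw : 1 ≤ A w
      1≤Aw = ≤-trans (≤-reflexive (≡.sym (δ-refl w))) (m≤m+n _ _)
      1≤Au : 1 ≤ A u
      1≤Au = ≤-trans (≤-reflexive (≡.sym (δ-refl u))) (m≤n+m _ _)
      ok : ∀ v → A v ≡ 0 ⊎ (A v ≤ 1 × Left v)
      ok v with w ≟ v | u ≟ v
      ... | yes refl | yes refl = ⊥-elim (~⇒≢ w~u refl)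
      ... | yes refl | no _     = inj₂ (≤-refl , lw)
      ... | no _     | yes refl = inj₂ (≤-refl , lu)
      ... | no _     | no _     = inj₁ refl

    -- If all neighbours except possibly `t` were in M, absorbing `b` would gain at least 2 (deg b -
    -- 1), which is no less than deg b + 2 because the degree is at least four.
    second-nbr : ∀ {b} → Left b → 4 ≤ deg b → ∀ t → ∃ λ w → w ≢ t × b ~ w × M w ≡ 0
    second-nbr {b} left 4≤ t with any? (λ w → ¬? (w ≟ t) ×-dec ((b ~? w) ×-dec (M w ℕ.≟ 0)))
    ... | yes p = p
    ... | no ¬p = ⊥-elim (single left (≤-trans (≤-reflexive (cost-big 4≤)) bound))
      where
      cover : ∀ {w} → b ~ w → 1 ≤ M w + δ t w
      cover {w} b~w with w ≟ t
      ... | yes refl = ≤-trans (≤-reflexive (≡.sym (δ-refl w))) (m≤n+m _ _)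
      ... | no w≢t = ≤-trans (M≥1 λ Mw → ¬p (w , w≢t , b~w , Mw)) (m≤m+n _ _)
      deg≤1+d : deg b ≤ d M b + 1
      deg≤1+d = ≤-trans (deg-split M (δ t) cover) (≤-reflexive (cong (d M b +_) (sum-δ t)))
      3≤d : 3 ≤ d M b
      3≤d = +-cancelʳ-≤ 1 3 (d M b) (≤-trans 4≤ deg≤1+d)
      bound : deg b + 2 ≤ 2 * d M b
      bound = ≤-trans (+-monoˡ-≤ 2 deg≤1+d) (≤-trans (≤-reflexive (+-assoc (d M b) 1 2))
        (≤-trans (+-monoʳ-≤ (d M b) 3≤d) (≤-reflexive (cong (d M b +_) (≡.sym (+-identityʳ (d M b)))))))

    Cubics : (Fin n → ℕ) → Set
    Cubics s = ∀ v → s v ≡ 0 ⊎ (s v ≡ 1 × Left v × deg v ≤ 3)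

    -- Absorb c₁ and c₂ together with s: an edge at c₁ or c₂ counts twice unless it is one of the
    -- exceptional edges counted by x₁ and x₂.
    pair : ∀ {c₁ c₂ s} → Cubics s → c₁ ≢ c₂ → Left c₁ → Left c₂ → 4 ≤ deg c₁ → 4 ≤ deg c₂ →
           ∀ x₁ x₂ →
           (∀ {w} → c₁ ~ w → 1 ≤ (M ⊞ s) w + x₁ w) → (∀ {w} → c₂ ~ w → 1 ≤ (M ⊞ s) w + x₂ w) →
           sum s + 2 * (sum x₁ + sum x₂) ≤ 4 → ⊥
    pair {c₁} {c₂} {s} cubic c₁≢c₂ l₁ l₂ 4≤₁ 4≤₂ x₁ x₂ cover₁ cover₂ few =
      stuck A (room A ok) nonempty (≤-trans (≤-reflexive total-A) (≤-trans bound gain))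
      where
      P A : Fin n → ℕ
      P = δ c₁ ⊞ δ c₂
      A = P ⊞ s
      s-big : ∀ {c} → 4 ≤ deg c → s c ≡ 0
      s-big {c} 4≤ with cubic c
      ... | inj₁ sc = sc
      ... | inj₂ (_ , _ , ≤3) = ⊥-elim (impossible (≤-trans 4≤ ≤3))
      ok : ∀ v → A v ≡ 0 ⊎ (A v ≤ 1 × Left v)
      ok v with c₁ ≟ v | c₂ ≟ v
      ... | yes refl | yes refl = ⊥-elim (c₁≢c₂ refl)
      ... | yes refl | no _     = inj₂ (≤-reflexive (cong suc (s-big 4≤₁)) , l₁)
      ... | no _     | yes refl = inj₂ (≤-reflexive (cong suc (s-big 4≤₂)) , l₂)
      ... | no _     | no _ with cubic v
      ...   | inj₁ sv = inj₁ sv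
      ...   | inj₂ (sv , left , _) = inj₂ (≤-reflexive sv , left)
      nonempty : 1 ≤ sum A
      nonempty = unique≤sum {xs = c₁ ∷ []} A ([] ∷ [])
        (≤-trans (≤-reflexive (≡.sym (δ-refl c₁))) (≤-trans (m≤m+n _ _) (m≤m+n _ _)) ∷ [])
      total-s : total s ≡ sum s
      total-s = sum-cong-≗ λ v → lemma v
        where
        lemma : ∀ v → cost v * s v ≡ s v
        lemma v with cubic v
        ... | inj₁ sv rewrite sv = *-zeroʳ (cost v)
        ... | inj₂ (sv , _ , ≤3) rewrite cost-cubic ≤3 = +-identityʳ (s v)
      D₁ = deg c₁
      D₂ = deg c₂
      m = d (M ⊞ s) c₁ + d (M ⊞ s) c₂
      total-A : total A ≡ ((D₁ + 2) + (D₂ + 2)) + sum s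
      total-A = trans (total-⊞ P s) (cong₂ _+_ (trans (total-⊞ (δ c₁) (δ c₂))
                  (cong₂ _+_ (trans (total-δ c₁) (cost-big 4≤₁)) (trans (total-δ c₂) (cost-big 4≤₂)))) total-s)
      e-P : ∀ g → e P g ≡ d g c₁ + d g c₂
      e-P g = trans (e-⊞ˡ (δ c₁) (δ c₂) g) (cong₂ _+_ (e-δ c₁ g) (e-δ c₂ g))
      gain : 2 * m ≤ 2 * e A M + e A A
      gain = begin
        2 * m                                      ≡⟨ cong (2 *_) (≡.sym (e-P (M ⊞ s))) ⟩
        2 * e P (M ⊞ s)                            ≡⟨ cong (2 *_) (e-⊞ʳ P M s) ⟩
        2 * (e P M + e P s)                        ≡⟨ *-distribˡ-+ 2 (e P M) (e P s) ⟩
        2 * e P M + 2 * e P s                      ≤⟨ +-mono-≤ (*-monoʳ-≤ 2 with-M) with-s ⟩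
        2 * e A M + e A A                          ∎
        where
        open ≤-Reasoning
        with-M : e P M ≤ e A M
        with-M = ≤-trans (m≤m+n (e P M) (e s M)) (≤-reflexive (≡.sym (e-⊞ˡ P s M)))
        with-s : 2 * e P s ≤ e A A
        with-s = begin
          2 * e P s                        ≡⟨ cong (2 *_) (e-sym P s) ⟩
          2 * e s P                        ≤⟨ m≤m+n (2 * e s P) (e s s) ⟩
          2 * e s P + e s s                ≤⟨ m≤n+m (2 * e s P + e s s) (e P P) ⟩
          e P P + (2 * e s P + e s s)      ≡⟨ ≡.sym (e-square P s) ⟩
          e A A                            ∎
      X = sum x₁ + sum x₂
      degrees : D₁ + D₂ ≤ m + X
      degrees = ≤-trans (+-mono-≤ (deg-split (M ⊞ s) x₁ cover₁) (deg-split (M ⊞ s) x₂ cover₂))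
        (≤-reflexive (+-interchange (d (M ⊞ s) c₁) (sum x₁) (d (M ⊞ s) c₂) (sum x₂)))
        where
        +-interchange : ∀ a b c d → (a + b) + (c + d) ≡ (a + c) + (b + d)
        +-interchange = 
          solve 4 (λ a b c d → (a :+ b) :+ (c :+ d) := (a :+ c) :+ (b :+ d)) refl
      bound : ((D₁ + 2) + (D₂ + 2)) + sum s ≤ 2 * m
      bound = +-cancelʳ-≤ (2 * X) _ _ (begin
        ((D₁ + 2) + (D₂ + 2)) + sum s + 2 * X      ≡⟨ arrange D₁ D₂ (sum s) X ⟩
        (D₁ + D₂ + 4) + (sum s + 2 * X)            ≤⟨ +-monoʳ-≤ (D₁ + D₂ + 4) few ⟩
        (D₁ + D₂ + 4) + 4                          ≡⟨ +-assoc (D₁ + D₂) 4 4 ⟩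
        -- The fixed cost 2 of each of the two vertices and the allowance 4 of `few` make 8, which
        -- two degrees of at least four repay.
        (D₁ + D₂) + 8                              ≤⟨ +-monoʳ-≤ (D₁ + D₂) (+-mono-≤ 4≤₁ 4≤₂) ⟩
        (D₁ + D₂) + (D₁ + D₂)                      ≤⟨ +-mono-≤ degrees degrees ⟩
        (m + X) + (m + X)                          ≡⟨ double m X ⟩
        2 * m + 2 * X                              ∎)
        where
        open ≤-Reasoning
        arrange : ∀ a b c x → ((a + 2) + (b + 2)) + c + 2 * x ≡ (a + b + 4) + (c + 2 * x)
        arrange = 
          solve 4 (λ a b c x → ((a :+ con 2) :+ (b :+ con 2)) :+ c :+ con 2 :* x := (a :+ b :+ con 4) :+ (c :+ con 2 :* x)) refl
        double : ∀ a x → (a + x) + (a + x) ≡ 2 * a + 2 * x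
        double = 
          solve 2 (λ a x → (a :+ x) :+ (a :+ x) := con 2 :* a :+ con 2 :* x) refl

-- The descent

module Minimal {n : ℕ} (G : Graph n) (minimal : MinimallyThreeConnected G) where
  open Separations G
  open Three G (proj₁ minimal)

  good-pair : ∀ {c d} → c ~ d → 4 ≤ deg c → 4 ≤ deg d → ¬ (∀ (ρ : Sides n) → ¬ Good ρ c d)
  good-pair c~d = good-edge (proj₂ minimal _ _ c~d) c~d

  big⇒sturdy : ∀ {v} → 4 ≤ deg v → Sturdy v
  big⇒sturdy 4≤ _ _ = 4≤

  other-nbr : ∀ v t → ∃ λ w → v ~ w × w ≢ t
  other-nbr v t with any? (λ w → (v ~? w) ×-dec ¬? (w ≟ t))
  ... | yes p = p
  ... | no ¬p = ⊥-elim (impossible (≤-trans (deg≥3 v) (≤-trans (deg≤ (λ _ → lo) (t ∷ []) near)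
                  (≤-reflexive (cong (_+ 1) (sum-zero {n} {λ _ → 0} λ _ → refl))))))
    where
    near : ∀ {w} → v ~ w → lo ≡ mid ⊎ w ∈ t ∷ []
    near {w} v~w with w ≟ t
    ... | yes eq = inj₂ (here eq)
    ... | no w≢t = ⊥-elim (¬p (w , v~w , w≢t))

  third-nbr : ∀ v s t → ∃ λ w → v ~ w × w ≢ s × w ≢ t
  third-nbr v s t with any? (λ w → (v ~? w) ×-dec (¬? (w ≟ s) ×-dec ¬? (w ≟ t)))
  ... | yes p = p
  ... | no ¬p = ⊥-elim (impossible (≤-trans (deg≥3 v) (≤-trans (deg≤ (λ _ → lo) (s ∷ t ∷ []) near)
                  (≤-reflexive (cong (_+ 2) (sum-zero {n} {λ _ → 0} λ _ → refl))))))
    where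
    near : ∀ {w} → v ~ w → lo ≡ mid ⊎ w ∈ s ∷ t ∷ []
    near {w} v~w with w ≟ s | w ≟ t
    ... | yes eq | _ = inj₂ (here eq)
    ... | no _ | yes eq = inj₂ (there (here eq))
    ... | no w≢s | no w≢t = ⊥-elim (¬p (w , v~w , w≢s , w≢t))

  -- If all degrees were at least four, every edge would have a `Good` separation. Uncrossing one
  -- with that of another edge at the same lower end `y` would make the lower side smaller forever.
  -- Here `r` is any upper vertex outside the other separator.
  cubic-exists : ∃ λ v → deg v ≤ 3
  cubic-exists with any? (λ v → deg v ≤? 3)
  ... | yes p = p
  ... | no none = ⊥-elim (good-pair v₀~w (big v₀) (big w) λ ρ → descend (suc (#lo ρ)) ≤-refl)
    where
    big : ∀ v → 4 ≤ deg v
    big v = ≰⇒> λ ≤3 → none (v , ≤3)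
    v₀ w : Fin n
    v₀ = fromℕ< 3<n
    w = proj₁ (other-nbr v₀ v₀)
    v₀~w = proj₁ (proj₂ (other-nbr v₀ v₀))
    descend : ∀ k {ρ : Sides n} {y x} → #lo ρ < k → ¬ Good ρ y x
    descend (suc k) {ρ} {y} {x} bound good with other-nbr y x
    ... | d , y~d , d≢x = good-pair y~d (big y) (big d) uncrossed
      where
      open Good good
      uncrossed : ∀ τ → ¬ Good τ y d
      uncrossed τ goodτ with any? (λ r → (ρ r ≟ˢ hi) ×-dec ¬? (τ r ≟ˢ mid))
      ... | yes (r , ρr , τr) = next (uncross good goodτ (big⇒sturdy (big y)) (big⇒sturdy (big y))
                                  (big⇒sturdy (big d)) y∈lo (d≢x ∘ proj₂) ρr τr)
        where
        next : (∃ λ σ → (Good σ y x ⊎ Good σ y d ⊎ Good σ d y) × σ r ≡ hi × #lo σ < #lo ρ) → ⊥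
        next (σ , inj₁ g        , _ , less) = descend k (≤-trans less (≤-pred bound)) g
        next (σ , inj₂ (inj₁ g) , _ , less) = descend k (≤-trans less (≤-pred bound)) g
        next (σ , inj₂ (inj₂ g) , _ , less) = descend k (≤-trans less (≤-pred bound)) g
      -- The upper side of `ρ` lies in the separator of `τ`, so it is just `x` and `x′`, and `x′`
      -- has degree at most three.
      ... | no covered = impossible (≤-trans (big x′) (≤-trans (deg≤ ρ (x ∷ []) near) (+-monoˡ-≤ 1 small)))
        where
        x′ : Fin n
        x′ = proj₁ more-hi
        x′≢x = proj₁ (proj₂ more-hi)
        ρx′ = proj₂ (proj₂ more-hi)
        in-mid : ∀ {w} → ρ w ≡ hi → τ w ≡ mid
        in-mid {w} ρw with τ w ≟ˢ mid
        ... | yes p = p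
        ... | no τw = ⊥-elim (covered (w , ρw , τw))
        near : ∀ {w} → x′ ~ w → ρ w ≡ mid ⊎ w ∈ x ∷ []
        near {w} x′~w with ρ w in ρw
        ... | mid = inj₁ refl
        ... | lo  = ⊥-elim (x′≢x (proj₂ (only (~-sym x′~w , ρw , ρx′))))
        ... | hi with w ≟ x
        ...   | yes eq = inj₂ (here eq)
        ...   | no w≢x = ⊥-elim (impossible (≤-trans (mids≤ τ {w ∷ x ∷ x′ ∷ []}
                  ((w≢x ∷ (~⇒≢ x′~w ∘ ≡.sym) ∷ []) ∷ ((x′≢x ∘ ≡.sym) ∷ []) ∷ [] ∷ [])
                  (in-mid ρw ∷ in-mid x∈hi ∷ in-mid ρx′ ∷ [])) (Good.small goodτ)))

  module Critical (critical : CriticallyThreeConnected G) where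
    open Potential G

    -- No separation of a leftover edge exists

    module Descent {v₀ : Fin n} (v₀-cubic : deg v₀ ≤ 3) {M : Fin n → ℕ}
      (bounded : ∀ v → M v + δ v₀ v ≤ 1)
      (stuck : ∀ A → (∀ v → A v + (M v + δ v₀ v) ≤ 1) → 1 ≤ sum A → ¬ total A ≤ 2 * e A M + e A A)
      where
      open Stuck {v₀} {M} bounded stuck

      big-nbr : ∀ {w u} → Left w → deg w ≤ 3 → w ~ u → u ≢ v₀ → Left u × 4 ≤ deg u
      big-nbr {w} {u} lw w≤3 w~u u≢v₀ = lu , ≰⇒> λ u≤3 → cubic-indep lw lu w≤3 u≤3 w~u
        where
        lu : Left u
        lu = cubic-nbr lw w≤3 w~u , u≢v₀

      free⇒sturdy : ∀ {w} → Left w → deg w ≤ 3 → ¬ w ~ v₀ → Sturdy w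
      free⇒sturdy lw w≤3 w≁v₀ w~u u≤3 =
        ⊥-elim (impossible (≤-trans (proj₂ (big-nbr lw w≤3 w~u λ { refl → w≁v₀ w~u })) u≤3))

      -- All neighbours of `w` are leftover and of degree at least four, so `good-at` applies and
      -- whichever edge it returns has a leftover sturdy upper end.
      good-free : ∀ {w} → Left w → deg w ≤ 3 → ¬ w ~ v₀ →
                  ¬ (∀ {u} (ρ : Sides n) → Left u → Sturdy u → ¬ Good ρ w u)
      good-free {w} lw w≤3 w≁v₀ none = good-at (proj₂ critical w) w≤3
        (λ w~u → proj₂ (nbr w~u))
        (λ ρ good → none ρ (proj₁ (nbr (Good.y~x good))) (big⇒sturdy (proj₂ (nbr (Good.y~x good)))) good)
        where
        nbr : ∀ {u} → w ~ u → Left u × 4 ≤ deg u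
        nbr w~u = big-nbr lw w≤3 w~u λ { refl → w≁v₀ w~u }

      record State (ρ : Sides n) (y x : Fin n) : Set where
        constructor state
        field
          good : Good ρ y x
          left-y : Left y
          left-x : Left x
          sturdy-y : Sturdy y
          sturdy-x : Sturdy x
          v₀∈hi : ρ v₀ ≡ hi

      module Step {ρ : Sides n} {y x} (st : State ρ y x)
        (smaller : ∀ {σ y′ x′} → State σ y′ x′ → ¬ #lo σ < #lo ρ) where
        open State st
        open Good good

        -- `shift` takes `v₀` off the separator of `τ`; with `v₀` as reference vertex, `uncross`
        -- would then produce a smaller state.
        only-good : ∀ {τ : Sides n} {c d} → Good τ c d → Left c → Left d → Sturdy c → Sturdy d →
                    ρ c ≡ lo → c ≡ y × d ≡ x
        only-good {τ} {c} {d} goodτ lc ld sc sd ρc with (c ≟ y) ×-dec (d ≟ x)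
        ... | yes eqs = eqs
        ... | no distinct with shift goodτ sc sd v₀-cubic
        ...   | τ′ , goodτ′ , τ′v₀ = ⊥-elim (next (uncross good goodτ′ sturdy-y sc sd ρc distinct v₀∈hi τ′v₀))
          where
          next : (∃ λ σ → (Good σ y x ⊎ Good σ c d ⊎ Good σ d c) × σ v₀ ≡ hi × #lo σ < #lo ρ) → ⊥
          next (σ , inj₁ g        , σv₀ , less) = smaller (state g left-y left-x sturdy-y sturdy-x σv₀) less
          next (σ , inj₂ (inj₁ g) , σv₀ , less) = smaller (state g lc ld sc sd σv₀) less
          next (σ , inj₂ (inj₂ g) , σv₀ , less) = smaller (state g ld lc sd sc σv₀) less

        only-big : ∀ {c d} → c ~ d → 4 ≤ deg c → 4 ≤ deg d → Left c → Left d → ρ c ≡ lo → c ≡ y × d ≡ x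
        only-big {c} {d} c~d 4≤c 4≤d lc ld ρc with (c ≟ y) ×-dec (d ≟ x)
        ... | yes eqs = eqs
        ... | no distinct = ⊥-elim (good-pair c~d 4≤c 4≤d λ τ g →
                distinct (only-good g lc ld (big⇒sturdy 4≤c) (big⇒sturdy 4≤d) ρc))

        lo≁v₀ : ∀ {u} → ρ u ≡ lo → ¬ u ~ v₀
        lo≁v₀ ρu u~v₀ = proj₂ left-x (≡.sym (proj₂ (only (u~v₀ , ρu , v₀∈hi))))

        -- Since `w` is not adjacent to `v₀`, criticality gives a separation of an edge at `w`, and
        -- `only-good` identifies its lower end with `y`.
        lo-cubic : ∀ {w} → Left w → deg w ≤ 3 → ρ w ≡ lo → w ≡ y
        lo-cubic {w} lw w≤3 ρw with w ≟ y
        ... | yes eq = eq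
        ... | no w≢y = ⊥-elim (good-free lw w≤3 (lo≁v₀ ρw) λ τ lu su g →
                w≢y (proj₁ (only-good g lw lu (free⇒sturdy lw w≤3 (lo≁v₀ ρw)) su ρw)))

        -- The vertices of degree three absorbed along with a pair from the lower side; being in the
        -- separator, there are at most two.
        Hinge : Fin n → Set
        Hinge w = Left w × deg w ≤ 3 × ρ w ≡ mid

        hinge? : ∀ w → Dec (Hinge w)
        hinge? w = left? w ×-dec ((deg w ≤? 3) ×-dec (ρ w ≟ˢ mid))

        s : Fin n → ℕ
        s w = member (hinge? w)

        sum-s : sum s ≤ 2
        sum-s = ≤-trans (sum-mono pointwise) small
          where
          pointwise : ∀ w → s w ≤ isMid (ρ w)
          pointwise w with member-case (hinge? w)
          ... | inj₁ eq = ≤-trans (≤-reflexive eq) z≤n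
          ... | inj₂ (eq , _ , _ , ρw) = ≤-reflexive (trans eq (cong isMid (≡.sym ρw)))

        -- Apart from the edge `y x`, every neighbour outside M has degree three, by `only-big`, and
        -- is `y` or a separating vertex, by `lo-cubic`. So absorbing the hinges, and `y` if it has
        -- degree three, secures all other edges at `c`.
        nbr-kind : ∀ {c w} → Left c → 4 ≤ deg c → ρ c ≡ lo → c ~ w → M w ≡ 0 →
                   (c ≡ y × w ≡ x) ⊎ (w ≡ y × deg y ≤ 3) ⊎ Hinge w
        nbr-kind {c} {w} lc 4≤c ρc c~w Mw with w ≟ v₀
        ... | yes refl = ⊥-elim (lo≁v₀ ρc c~w)
        ... | no w≢v₀ with deg w ≤? 3
        ...   | no ≰3 = inj₁ (only-big c~w 4≤c (≰⇒> ≰3) lc (Mw , w≢v₀) ρc)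
        ...   | yes ≤3 with ρ w in ρw
        ...     | mid = inj₂ (inj₂ ((Mw , w≢v₀) , ≤3 , refl))
        ...     | hi  = inj₁ (only (c~w , ρc , ρw))
        ...     | lo with lo-cubic (Mw , w≢v₀) ≤3 ρw
        ...       | refl = inj₂ (inj₁ (refl , ≤3))

        lo-nbr : ∀ {w u} → Left w → deg w ≤ 3 → w ~ u → ρ u ≡ lo → Left u × 4 ≤ deg u
        lo-nbr lw w≤3 w~u ρu = big-nbr lw w≤3 w~u λ { refl → clash ρu v₀∈hi (lo≢hi ∘ ≡.sym) }

        -- A hinge w with a single lower neighbour a moves up, a taking its place.
        module Push {w a} (ρw : ρ w ≡ mid) (ρa : ρ a ≡ lo)
          (alone : ∀ {u} → w ~ u → ρ u ≡ lo → u ≡ a) where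

          τ : Sides n
          τ = ρ [ w ]≔ hi [ a ]≔ mid

          τ-small : #mid τ ≤ 2
          τ-small = ≤-trans (#mid-grow (ρ [ w ]≔ hi) a mid) (≤-trans (#mid-shrink ρ w hi ρw refl) small)

          τ-cross : ∀ {u v} → Cross τ u v → u ≢ a × u ≡ y × v ≡ x
          τ-cross cr with Cross-≔mid {ρ [ w ]≔ hi} cr
          ... | (u~v , u∈ , v∈) , a≢u , a≢v with ≔-inv ρ w hi u∈ | ≔-inv ρ w hi v∈
          ...   | inj₁ (_ , ()) | _
          ...   | inj₂ (_ , ρu) | inj₁ (refl , _) = ⊥-elim (a≢u (≡.sym (alone (~-sym u~v) ρu)))
          ...   | inj₂ (_ , ρu) | inj₂ (_ , ρv) = (a≢u ∘ ≡.sym) , only (u~v , ρu , ρv)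

          τ-lo : ∀ {u} → u ≢ a → ρ u ≡ lo → τ u ≡ lo
          τ-lo {u} u≢a ρu = trans (≔-other (ρ [ w ]≔ hi) mid (u≢a ∘ ≡.sym))
            (trans (≔-other ρ {w} hi λ { refl → clash ρu ρw (lo≢mid ∘ ≡.sym) }) ρu)

          τ-hi : ∀ {u} → ρ u ≡ hi → τ u ≡ hi
          τ-hi {u} ρu with a ≟ u
          ... | yes refl = clash ρa ρu (lo≢hi ∘ ≡.sym)
          ... | no _ with w ≟ u
          ...   | yes _ = refl
          ...   | no _  = ρu

          τ-lo-inv : ∀ u → τ u ≡ lo → ρ u ≡ lo × u ≢ a
          τ-lo-inv u τu with ≔-inv (ρ [ w ]≔ hi) a mid τu
          ... | inj₁ (_ , ())
          ... | inj₂ (a≢u , u∈) with ≔-inv ρ w hi u∈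
          ...   | inj₁ (_ , ())
          ...   | inj₂ (_ , ρu) = ρu , a≢u ∘ ≡.sym

        hinge⇒s : ∀ {w} → Hinge w → 1 ≤ s w
        hinge⇒s {w} = member-yes (hinge? w)

        ≥M : ∀ {w k} → M w ≢ 0 → 1 ≤ (M w + s w) + k
        ≥M M≢0 = ≤-trans (M≥1 M≢0) (≤-trans (m≤m+n _ _) (m≤m+n _ _))

        ≥s : ∀ {w k} → 1 ≤ s w → 1 ≤ (M w + s w) + k
        ≥s {w} 1≤ = ≤-trans 1≤ (≤-trans (m≤n+m _ (M w)) (m≤m+n _ _))

        partner? : ∀ a → Dec (∃ λ c → c ≢ a × Left c × 4 ≤ deg c × ρ c ≡ lo)
        partner? a = any? (λ c → ¬? (c ≟ a) ×-dec (left? c ×-dec ((4 ≤? deg c) ×-dec (ρ c ≟ˢ lo))))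

        -- Two hinges and the one exceptional edge `y x`, weighted 2, use up the allowance 4 of
        -- `pair`. Without a partner for `y`, some hinge has `y` as its only lower neighbour, and
        -- pushing it up moves `y` into the separator, so no crossing edge is left.
        big-head : 4 ≤ deg y → ⊥
        big-head 4≤y with partner? y
        ... | yes (c , c≢y , lc , 4≤c , ρc) =
          pair (λ v → map₂ (λ { (eq , lv , v≤3 , _) → eq , lv , v≤3 }) (member-case (hinge? v)))
            (c≢y ∘ ≡.sym) left-y lc 4≤y 4≤c (δ x) (λ _ → 0) cover-y cover-c
            (+-mono-≤ sum-s (≤-reflexive (cong (2 *_) (cong₂ _+_ (sum-δ x) (sum-zero {n} {λ _ → 0} λ _ → refl)))))
          where
          cover-y : ∀ {w} → y ~ w → 1 ≤ (M w + s w) + δ x w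
          cover-y {w} y~w with M w ℕ.≟ 0
          ... | no M≢0 = ≥M M≢0
          ... | yes Mw with nbr-kind left-y 4≤y y∈lo y~w Mw
          ...   | inj₁ (_ , refl) = ≤-trans (≤-reflexive (≡.sym (δ-refl x))) (m≤n+m _ _)
          ...   | inj₂ (inj₁ (_ , y≤3)) = ⊥-elim (impossible (≤-trans 4≤y y≤3))
          ...   | inj₂ (inj₂ hinge) = ≥s (hinge⇒s hinge)
          cover-c : ∀ {w} → c ~ w → 1 ≤ (M w + s w) + 0
          cover-c {w} c~w with M w ℕ.≟ 0
          ... | no M≢0 = ≥M M≢0
          ... | yes Mw with nbr-kind lc 4≤c ρc c~w Mw
          ...   | inj₁ (eq , _) = ⊥-elim (c≢y eq)
          ...   | inj₂ (inj₁ (_ , y≤3)) = ⊥-elim (impossible (≤-trans 4≤y y≤3))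
          ...   | inj₂ (inj₂ hinge) = ≥s (hinge⇒s hinge)
        ... | no alone with second-nbr left-y 4≤y x
        ...   | w , w≢x , y~w , Mw with nbr-kind left-y 4≤y y∈lo y~w Mw
        ...     | inj₁ (_ , eq) = w≢x eq
        ...     | inj₂ (inj₁ (_ , y≤3)) = impossible (≤-trans 4≤y y≤3)
        ...     | inj₂ (inj₂ (lw , w≤3 , ρw)) =
                    connected {τ} (λ cr → let u≢y , u≡y , _ = τ-cross cr in u≢y u≡y)
                      (τ-lo (proj₁ (proj₂ more-lo)) (proj₂ (proj₂ more-lo))) (τ-hi x∈hi) τ-small
          where
          only-y : ∀ {u} → w ~ u → ρ u ≡ lo → u ≡ y
          only-y {u} w~u ρu with u ≟ y
          ... | yes eq = eq
          ... | no u≢y = let lu , 4≤u = lo-nbr lw w≤3 w~u ρu in ⊥-elim (alone (u , u≢y , lu , 4≤u , ρu))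
          open Push ρw y∈lo only-y

        -- Now `y` is absorbed as a third vertex of degree three and there is no exceptional edge,
        -- so 3 of the allowance 4 are used. A lower neighbour `c` exists, or `y` could move up and
        -- leave no crossing edge. Without a partner for `c`, pushing a hinge up in exchange for `c`
        -- gives a smaller state with the same edge.
        cubic-head : deg y ≤ 3 → ⊥
        cubic-head y≤3 with any? (λ u → (y ~? u) ×-dec (ρ u ≟ˢ lo))
        ... | no ¬u = connected {ρ [ y ]≔ hi} un
                (trans (≔-other ρ hi (proj₁ (proj₂ more-lo) ∘ ≡.sym)) (proj₂ (proj₂ more-lo)))
                (≔-same ρ y hi) (≤-trans (#mid-keep ρ y hi refl) small)
          where
          un : Uncrossed (ρ [ y ]≔ hi)
          un (u~v , u∈ , v∈) with ≔-inv ρ y hi u∈ | ≔-inv ρ y hi v∈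
          ... | inj₁ (_ , ()) | _
          ... | inj₂ (_ , ρu) | inj₁ (refl , _) = ¬u (_ , ~-sym u~v , ρu)
          ... | inj₂ (y≢u , ρu) | inj₂ (_ , ρv) = y≢u (≡.sym (proj₁ (only (u~v , ρu , ρv))))
        ... | yes (c , y~c , ρc) with lo-nbr left-y y≤3 y~c ρc
        ...   | lc , 4≤c with partner? c
        ...     | yes (c′ , c′≢c , lc′ , 4≤c′ , ρc′) =
          pair cubic-s′ (c′≢c ∘ ≡.sym) lc lc′ 4≤c 4≤c′ (λ _ → 0) (λ _ → 0)
            (cover lc 4≤c ρc) (cover lc′ 4≤c′ ρc′) few
          where
          s′ : Fin n → ℕ
          s′ = s ⊞ δ y
          cubic-s′ : ∀ v → s′ v ≡ 0 ⊎ (s′ v ≡ 1 × Left v × deg v ≤ 3)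
          cubic-s′ v with y ≟ v | member-case (hinge? v)
          ... | yes refl | inj₁ eq = inj₂ (cong (_+ 1) eq , left-y , y≤3)
          ... | yes refl | inj₂ (_ , _ , _ , ρv) = clash y∈lo ρv (lo≢mid ∘ ≡.sym)
          ... | no _ | inj₁ eq = inj₁ (cong (_+ 0) eq)
          ... | no _ | inj₂ (eq , lv , v≤3 , _) = inj₂ (cong (_+ 0) eq , lv , v≤3)
          cover : ∀ {a} → Left a → 4 ≤ deg a → ρ a ≡ lo → ∀ {w} → a ~ w → 1 ≤ (M w + s′ w) + 0
          cover la 4≤a ρa {w} a~w with M w ℕ.≟ 0
          ... | no M≢0 = ≤-trans (M≥1 M≢0) (≤-trans (m≤m+n _ _) (m≤m+n _ _))
          ... | yes Mw with nbr-kind la 4≤a ρa a~w Mw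
          ...   | inj₁ (refl , _) = ⊥-elim (impossible (≤-trans 4≤a y≤3))
          ...   | inj₂ (inj₁ (refl , _)) = ≤-trans (≤-trans (≤-reflexive (≡.sym (δ-refl y))) (m≤n+m _ (s y)))
                    (≤-trans (m≤n+m _ (M y)) (m≤m+n _ _))
          ...   | inj₂ (inj₂ hinge) = ≤-trans (≤-trans (hinge⇒s hinge) (m≤m+n _ _)) (≤-trans (m≤n+m _ (M w)) (m≤m+n _ _))
          few : sum s′ + 2 * (sum {n} (λ _ → 0) + sum {n} (λ _ → 0)) ≤ 4
          few = begin
            sum s′ + 2 * (sum {n} (λ _ → 0) + sum {n} (λ _ → 0))  ≡⟨ cong₂ (λ a b → a + 2 * (b + b))
                 (trans (∑-distrib-+ s (δ y)) (cong (sum s +_) (sum-δ y))) (sum-zero {n} {λ _ → 0} λ _ → refl) ⟩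
            (sum s + 1) + 0                                        ≤⟨ +-monoˡ-≤ 0 (+-monoˡ-≤ 1 sum-s) ⟩
            3                                                      ≤⟨ n≤1+n 3 ⟩
            4                                                      ∎
            where open ≤-Reasoning
        ...     | no alone with second-nbr lc 4≤c y
        ...       | w , w≢y , c~w , Mw with nbr-kind lc 4≤c ρc c~w Mw
        ...         | inj₁ (refl , _) = impossible (≤-trans 4≤c y≤3)
        ...         | inj₂ (inj₁ (eq , _)) = w≢y eq
        ...         | inj₂ (inj₂ (lw , w≤3 , ρw)) = smaller
                        (state (mkGood (mkSep y~x (τ-lo (~⇒≢ y~c) y∈lo) (τ-hi x∈hi) (λ cr → proj₂ (τ-cross cr)) τ-small)
                          third (let u , u≢x , ρu = more-hi in u , u≢x , τ-hi ρu))
                          left-y left-x sturdy-y sturdy-x (τ-hi v₀∈hi))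
                        (#lo-strict c τ-lo-inv ρc)
          where
          only-c : ∀ {u} → w ~ u → ρ u ≡ lo → u ≡ c
          only-c {u} w~u ρu with u ≟ c
          ... | yes eq = eq
          ... | no u≢c = let lu , 4≤u = lo-nbr lw w≤3 w~u ρu in ⊥-elim (alone (u , u≢c , lu , 4≤u , ρu))
          open Push ρw ρc only-c
          third : ∃ λ u → u ≢ y × τ u ≡ lo
          third with any? (λ u → ¬? (u ≟ y) ×-dec (¬? (u ≟ c) ×-dec (ρ u ≟ˢ lo)))
          ... | yes (u , u≢y , u≢c , ρu) = u , u≢y , τ-lo u≢c ρu
          ... | no none = ⊥-elim (impossible (≤-trans (proj₁ (lo-pair good sturdy-y (~⇒≢ y~c ∘ ≡.sym) ρc two)) y≤3))
            where
            two : ∀ {u} → ρ u ≡ lo → u ≡ y ⊎ u ≡ c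
            two {u} ρu with u ≟ y | u ≟ c
            ... | yes eq | _ = inj₁ eq
            ... | no _ | yes eq = inj₂ eq
            ... | no u≢y | no u≢c = ⊥-elim (none (u , u≢y , u≢c , ρu))

        contradiction : ⊥
        contradiction with deg y ≤? 3
        ... | yes ≤3 = cubic-head ≤3
        ... | no ≰3  = big-head (≰⇒> ≰3)

      descend : ∀ k {ρ : Sides n} {y x} → #lo ρ < k → ¬ State ρ y x
      descend (suc k) bound st = Step.contradiction st λ st′ less → descend k (≤-trans less (≤-pred bound)) st′

      -- After `shift`, `v₀` is on one of the sides, and reversing the separation if necessary makes
      -- it the upper one.
      no-good : ∀ {ρ : Sides n} {c d} → Left c → Left d → Sturdy c → Sturdy d → ¬ Good ρ c d
      no-good lc ld sc sd good with shift good sc sd v₀-cubic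
      ... | τ , goodτ , τv₀ with τ v₀ in eq
      ...   | hi  = descend _ ≤-refl (state goodτ lc ld sc sd eq)
      ...   | lo  = descend _ ≤-refl (state (Good-ᵒ goodτ) ld lc sd sc (cong flip eq))
      ...   | mid = τv₀ refl

      no-big-edge : ∀ {c d} → Left c → Left d → 4 ≤ deg c → 4 ≤ deg d → ¬ c ~ d
      no-big-edge lc ld 4≤c 4≤d c~d =
        good-pair c~d 4≤c 4≤d λ ρ → no-good lc ld (big⇒sturdy 4≤c) (big⇒sturdy 4≤d)

      cubic~v₀ : ∀ {w} → Left w → deg w ≤ 3 → w ~ v₀
      cubic~v₀ {w} lw w≤3 with w ~? v₀
      ... | yes p = p
      ... | no w≁v₀ = ⊥-elim (good-free lw w≤3 w≁v₀ λ ρ lu su →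
              no-good lw lu (free⇒sturdy lw w≤3 w≁v₀) su)

      -- A leftover vertex of degree at least four has a leftover neighbour, and two such vertices
      -- are never adjacent.
      some-cubic : ∀ {q} → Left q → ∃ λ w → Left w × deg w ≤ 3
      some-cubic {q} lq with deg q ≤? 3
      ... | yes ≤3 = q , lq , ≤3
      ... | no ≰3 with second-nbr lq (≰⇒> ≰3) v₀
      ...   | w , w≢v₀ , q~w , Mw with deg w ≤? 3
      ...     | yes ≤3 = w , (Mw , w≢v₀) , ≤3
      ...     | no w≰3 = ⊥-elim (no-big-edge lq (Mw , w≢v₀) (≰⇒> ≰3) (≰⇒> w≰3) q~w)

      -- The leftover vertices around `v₀`

      module Last {w} (lw : Left w) (w≤3 : deg w ≤ 3) where
        w~v₀ : w ~ v₀
        w~v₀ = cubic~v₀ lw w≤3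

        b₁ b₂ : Fin n
        b₁ = proj₁ (other-nbr w v₀)
        b₂ = proj₁ (third-nbr w v₀ b₁)

        w~b₁ : w ~ b₁
        w~b₁ = proj₁ (proj₂ (other-nbr w v₀))
        b₁≢v₀ : b₁ ≢ v₀
        b₁≢v₀ = proj₂ (proj₂ (other-nbr w v₀))
        w~b₂ : w ~ b₂
        w~b₂ = proj₁ (proj₂ (third-nbr w v₀ b₁))
        b₂≢v₀ : b₂ ≢ v₀
        b₂≢v₀ = proj₁ (proj₂ (proj₂ (third-nbr w v₀ b₁)))
        b₂≢b₁ : b₂ ≢ b₁
        b₂≢b₁ = proj₂ (proj₂ (proj₂ (third-nbr w v₀ b₁)))

        l₁ = proj₁ (big-nbr lw w≤3 w~b₁ b₁≢v₀)
        l₂ = proj₁ (big-nbr lw w≤3 w~b₂ b₂≢v₀)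
        4≤₁ = proj₂ (big-nbr lw w≤3 w~b₁ b₁≢v₀)
        4≤₂ = proj₂ (big-nbr lw w≤3 w~b₂ b₂≢v₀)

        -- Then `v₀` and `w` have no neighbours besides each other, `b₁` and `b₂`, so these two form
        -- a cut. If there is no fifth vertex, `b₁` has degree at most three.
        both : v₀ ~ b₁ → v₀ ~ b₂ → ⊥
        both v₀~b₁ v₀~b₂ = conclude
          where
          base τ : Sides n
          base = (λ _ → hi) [ v₀ ]≔ lo [ w ]≔ lo
          τ = base [ b₁ ]≔ mid [ b₂ ]≔ mid
          base-small : #mid base ≤ 0
          base-small = ≤-trans (#mid-keep ((λ _ → hi) [ v₀ ]≔ lo) w lo refl)
            (≤-trans (#mid-keep (λ _ → hi) v₀ lo refl) (≤-reflexive (sum-zero {n} {λ _ → 0} λ _ → refl)))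
          τ-small : #mid τ ≤ 2
          τ-small = ≤-trans (#mid-grow (base [ b₁ ]≔ mid) b₂ mid) (s≤s (≤-trans (#mid-grow base b₁ mid) (s≤s base-small)))
          τ-v₀ : τ v₀ ≡ lo
          τ-v₀ = trans (≔-other (base [ b₁ ]≔ mid) mid b₂≢v₀) (trans (≔-other base mid b₁≢v₀)
                   (trans (≔-other ((λ _ → hi) [ v₀ ]≔ lo) lo (~⇒≢ w~v₀)) (≔-same (λ _ → hi) v₀ lo)))
          full : ∀ {a c₁ c₂ c₃ u} → deg a ≤ 3 → a ~ c₁ → a ~ c₂ → a ~ c₃ → a ~ u →
                 c₁ ≢ c₂ → c₁ ≢ c₃ → c₂ ≢ c₃ → c₁ ≢ u → c₂ ≢ u → c₃ ≢ u → ⊥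
          full {a} {c₁} {c₂} {c₃} {u} ≤3 p₁ p₂ p₃ pu n₁₂ n₁₃ n₂₃ n₁ n₂ n₃ =
            impossible (≤-trans (nbrs≤deg {a} {c₁ ∷ c₂ ∷ c₃ ∷ u ∷ []}
              ((n₁₂ ∷ n₁₃ ∷ n₁ ∷ []) ∷ (n₂₃ ∷ n₂ ∷ []) ∷ (n₃ ∷ []) ∷ [] ∷ []) (p₁ ∷ p₂ ∷ p₃ ∷ pu ∷ [])) ≤3)
          un : Uncrossed τ
          un cr with Cross-≔mid {base [ b₁ ]≔ mid} {b₂} cr
          ... | cr₁ , _ , b₂≢v with Cross-≔mid {base} {b₁} cr₁
          ...   | (u~v , u∈ , v∈) , _ , b₁≢v with ≔-inv ((λ _ → hi) [ v₀ ]≔ lo) w lo v∈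
          ...     | inj₁ (_ , ())
          ...     | inj₂ (w≢v , v∈′) with ≔-inv (λ _ → hi) v₀ lo v∈′
          ...       | inj₁ (_ , ())
          ...       | inj₂ (v₀≢v , _) with ≔-inv ((λ _ → hi) [ v₀ ]≔ lo) w lo u∈
          ...         | inj₁ (refl , _) = full w≤3 w~v₀ w~b₁ w~b₂ u~v (b₁≢v₀ ∘ ≡.sym) (b₂≢v₀ ∘ ≡.sym) (b₂≢b₁ ∘ ≡.sym) v₀≢v b₁≢v b₂≢v
          ...         | inj₂ (_ , u∈′) with ≔-inv (λ _ → hi) v₀ lo u∈′
          ...           | inj₂ (_ , ())
          ...           | inj₁ (refl , _) = full v₀-cubic (~-sym w~v₀) v₀~b₁ v₀~b₂ u~v (~⇒≢ w~b₁) (~⇒≢ w~b₂) (b₂≢b₁ ∘ ≡.sym) w≢v b₁≢v b₂≢v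
          conclude : ⊥
          conclude with any? (λ u → τ u ≟ˢ hi)
          ... | yes (u , τu) = connected {τ} un τ-v₀ τu τ-small
          ... | no none = impossible (≤-trans 4≤₁ (≤-trans (deg≤ (λ _ → lo) (v₀ ∷ w ∷ b₂ ∷ []) near)
                            (≤-reflexive (cong (_+ 3) (sum-zero {n} {λ _ → 0} λ _ → refl)))))
            where
            near : ∀ {u} → b₁ ~ u → lo ≡ mid ⊎ u ∈ v₀ ∷ w ∷ b₂ ∷ []
            near {u} b₁~u with u ≟ v₀ | u ≟ w | u ≟ b₂
            ... | yes eq | _ | _ = inj₂ (here eq)
            ... | no _ | yes eq | _ = inj₂ (there (here eq))
            ... | no _ | no _ | yes eq = inj₂ (there (there (here eq)))
            ... | no u≢v₀ | no u≢w | no u≢b₂ = ⊥-elim (none (u , τu))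
              where
              τu : τ u ≡ hi
              τu = trans (≔-other (base [ b₁ ]≔ mid) mid (u≢b₂ ∘ ≡.sym)) (trans (≔-other base mid (~⇒≢ b₁~u))
                     (trans (≔-other ((λ _ → hi) [ v₀ ]≔ lo) lo (u≢w ∘ ≡.sym)) (≔-other (λ _ → hi) lo (u≢v₀ ∘ ≡.sym))))

        Rest : Fin n → Set
        Rest u = Left u × deg u ≤ 3

        rest? : ∀ u → Dec (Rest u)
        rest? u = left? u ×-dec (deg u ≤? 3)

        s : Fin n → ℕ
        s u = member (rest? u)

        rest⇒s : ∀ {u} → Rest u → 1 ≤ s u
        rest⇒s {u} = member-yes (rest? u)

        ε : Fin n → ℕ
        ε b = ⟦ adj G v₀ b ⟧

        cover : ∀ {b} → Left b → 4 ≤ deg b → ∀ {u} → b ~ u → 1 ≤ (M u + s u) + ε b * δ v₀ u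
        cover {b} lb 4≤b {u} b~u with M u ℕ.≟ 0
        ... | no M≢0 = ≤-trans (M≥1 M≢0) (≤-trans (m≤m+n _ _) (m≤m+n _ _))
        ... | yes Mu with ≡⊎≢ u v₀
        ...   | inj₁ refl = ≤-trans (≤-reflexive (≡.sym (cong₂ _*_ (cong ⟦_⟧ (~-sym b~u)) (δ-refl v₀)))) (m≤n+m _ _)
        ...   | inj₂ u≢v₀ with deg u ≤? 3
        ...     | yes ≤3 = ≤-trans (≤-trans (rest⇒s ((Mu , u≢v₀) , ≤3)) (m≤n+m _ (M u))) (m≤m+n _ _)
        ...     | no ≰3 = ⊥-elim (no-big-edge lb (Mu , u≢v₀) 4≤b (≰⇒> ≰3) b~u)

        sum-cover : ∀ b → sum (λ u → ε b * δ v₀ u) ≡ ε b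
        sum-cover b = trans (sum-*ˡ (ε b) (δ v₀)) (trans (cong (ε b *_) (sum-δ v₀)) (*-identityʳ (ε b)))

        -- The leftover vertices of degree three are all neighbours of `v₀`, neither `b₁` nor `b₂`
        -- is among them, and `v₀` has only three neighbours.
        count : sum s + (ε b₁ + ε b₂) ≤ 3
        count = ≤-trans (≤-trans (≤-reflexive (≡.sym split)) (sum-mono pointwise)) v₀-cubic
          where
          f : Fin n → ℕ
          f u = δ b₁ u * ε u + δ b₂ u * ε u
          split : sum (s ⊞ f) ≡ sum s + (ε b₁ + ε b₂)
          split = trans (∑-distrib-+ s f) (cong (sum s +_) (trans (∑-distrib-+ (λ u → δ b₁ u * ε u) (λ u → δ b₂ u * ε u))
                    (cong₂ _+_ (sum-pick b₁ ε) (sum-pick b₂ ε))))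
          s-big : ∀ {b} → 4 ≤ deg b → s b ≡ 0
          s-big {b} 4≤ with member-case (rest? b)
          ... | inj₁ eq = eq
          ... | inj₂ (_ , _ , ≤3) = ⊥-elim (impossible (≤-trans 4≤ ≤3))
          s≤ε : ∀ u → s u ≤ ε u
          s≤ε u with member-case (rest? u)
          ... | inj₁ eq = ≤-trans (≤-reflexive eq) z≤n
          ... | inj₂ (eq , lu , u≤3) = ≤-reflexive (trans eq (cong ⟦_⟧ (≡.sym (~-sym (cubic~v₀ lu u≤3)))))
          pointwise : ∀ u → s u + f u ≤ ε u
          pointwise u with b₁ ≟ u | b₂ ≟ u
          ... | yes eq₁ | yes eq₂ = ⊥-elim (b₂≢b₁ (trans eq₂ (≡.sym eq₁)))
          ... | yes refl | no _ = ≤-reflexive (trans (cong (_+ (ε b₁ + 0 + 0)) (s-big 4≤₁)) (trans (+-identityʳ _) (+-identityʳ _)))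
          ... | no _ | yes refl = ≤-reflexive (trans (cong (_+ (ε b₂ + 0)) (s-big 4≤₂)) (+-identityʳ _))
          ... | no _ | no _ = ≤-trans (≤-reflexive (+-identityʳ (s u))) (s≤ε u)

        ε≤1 : ∀ b → ε b ≤ 1
        ε≤1 b with adj G v₀ b
        ... | false = z≤n
        ... | true  = ≤-refl

        ε≤0 : ∀ {b} → ¬ v₀ ~ b → ε b ≤ 0
        ε≤0 {b} ¬p with adj G v₀ b
        ... | false = z≤n
        ... | true  = ⊥-elim (¬p refl)

        -- The exceptional edges for `pair` are those from `b₁` and `b₂` to `v₀`. One copy of their
        -- number is bounded together with `s` by `count`, the other by the hypothesis: 3 + 1 is the
        -- allowance 4.
        few : ε b₁ + ε b₂ ≤ 1 → ⊥
        few ≤1 = pair (λ u → member-case (rest? u)) (b₂≢b₁ ∘ ≡.sym) l₁ l₂ 4≤₁ 4≤₂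
          (λ u → ε b₁ * δ v₀ u) (λ u → ε b₂ * δ v₀ u) (cover l₁ 4≤₁) (cover l₂ 4≤₂) bound
          where
          open ≤-Reasoning
          E = ε b₁ + ε b₂
          bound : sum s + 2 * (sum (λ u → ε b₁ * δ v₀ u) + sum (λ u → ε b₂ * δ v₀ u)) ≤ 4
          bound = begin
            sum s + 2 * (sum (λ u → ε b₁ * δ v₀ u) + sum (λ u → ε b₂ * δ v₀ u))
              ≡⟨ cong (λ k → sum s + 2 * k) (cong₂ _+_ (sum-cover b₁) (sum-cover b₂)) ⟩
            sum s + 2 * E    ≡⟨ solve 2 (λ a x → a :+ con 2 :* x := (a :+ x) :+ x) refl (sum s) E ⟩
            (sum s + E) + E  ≤⟨ +-mono-≤ count ≤1 ⟩
            4                ∎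

        contradiction : ⊥
        contradiction with v₀ ~? b₁ | v₀ ~? b₂
        ... | yes p | yes q = both p q
        ... | no ¬p | _     = few (+-mono-≤ (ε≤0 ¬p) (ε≤1 b₂))
        ... | yes _ | no ¬q = few (+-mono-≤ (ε≤1 b₁) (ε≤0 ¬q))

      all-absorbed : ∀ {q} → ¬ Left q
      all-absorbed lq = let w , lw , w≤3 = some-cubic lq in Last.contradiction lw w≤3

    -- The fuel `k` bounds the number of vertices outside M. Refuting `no-end` turns the question
    -- whether more can be absorbed into the hypothesis `stuck`, so no search over the sets A is
    -- needed.
    absorb : ∀ {v₀} → deg v₀ ≤ 3 → ∀ k (M : Fin n → ℕ) → n ≤ sum M + k →
             (∀ v → M v + δ v₀ v ≤ 1) → total M ≤ e M M →
             ¬ (∀ M → (∀ v → M v + δ v₀ v ≡ 1) → ¬ total M ≤ e M M)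
    absorb {v₀} v₀≤3 zero M full bounded _ _ = <-irrefl refl (begin-strict
      n                      ≤⟨ full ⟩
      sum M + 0              ≡⟨ +-identityʳ (sum M) ⟩
      sum M                  <⟨ n<1+n (sum M) ⟩
      1 + sum M              ≡⟨ +-comm 1 (sum M) ⟩
      sum M + 1              ≡⟨ cong (sum M +_) (≡.sym (sum-δ v₀)) ⟩
      sum M + sum (δ v₀)     ≡⟨ ≡.sym (∑-distrib-+ M (δ v₀)) ⟩
      sum (M ⊞ δ v₀)         ≤⟨ sum-mono bounded ⟩
      sum {n} (λ _ → 1)      ≡⟨ sum-one n ⟩
      n                      ∎)
      where open ≤-Reasoning
    absorb {v₀} v₀≤3 (suc k) M full bounded positive no-end = no-end M everywhere positive
      where
      stuck : ∀ A → (∀ v → A v + (M v + δ v₀ v) ≤ 1) → 1 ≤ sum A → ¬ total A ≤ 2 * e A M + e A A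
      stuck A fits nonempty gain = absorb v₀≤3 k (M ⊞ A) full′ bounded′ positive′ no-end
        where
        open ≤-Reasoning
        full′ : n ≤ sum (M ⊞ A) + k
        full′ = begin
          n                      ≤⟨ full ⟩
          sum M + suc k          ≡⟨ +-suc (sum M) k ⟩
          suc (sum M + k)        ≡⟨ cong (_+ k) (+-comm 1 (sum M)) ⟩
          sum M + 1 + k          ≤⟨ +-monoˡ-≤ k (+-monoʳ-≤ (sum M) nonempty) ⟩
          sum M + sum A + k      ≡⟨ cong (_+ k) (≡.sym (∑-distrib-+ M A)) ⟩
          sum (M ⊞ A) + k        ∎
        bounded′ : ∀ v → M v + A v + δ v₀ v ≤ 1
        bounded′ v = ≤-trans (≤-reflexive (solve 3 (λ m a x → m :+ a :+ x := a :+ (m :+ x)) refl (M v) (A v) (δ v₀ v))) (fits v)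
        positive′ : total (M ⊞ A) ≤ e (M ⊞ A) (M ⊞ A)
        positive′ = begin
          total (M ⊞ A)                    ≡⟨ total-⊞ M A ⟩
          total M + total A                ≤⟨ +-mono-≤ positive gain ⟩
          e M M + (2 * e A M + e A A)      ≡⟨ ≡.sym (e-square M A) ⟩
          e (M ⊞ A) (M ⊞ A)                ∎
      everywhere : ∀ v → M v + δ v₀ v ≡ 1
      everywhere v with M v ℕ.≟ 0 | v ≟ v₀
      ... | yes Mv | no v≢v₀ = ⊥-elim (Descent.all-absorbed v₀≤3 bounded stuck (Mv , v≢v₀))
      ... | _ | yes refl = ≤-antisym (bounded v) (≤-trans (≤-reflexive (≡.sym (δ-refl v))) (m≤n+m _ (M v)))
      ... | no M≢0 | no _ = ≤-antisym (bounded v) (≤-trans M≥1 (m≤m+n _ _))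
        where
        M≥1 : 1 ≤ M v
        M≥1 with M v
        ... | zero  = ⊥-elim (M≢0 refl)
        ... | suc _ = s≤s z≤n

    -- The final count

    v₃-count : sum cost + 4 * v₃ G ≡ sum deg + 2 * n
    v₃-count = begin
      sum cost + 4 * v₃ G                                  ≡⟨ cong (λ k → sum cost + 4 * k) (∣tabulate∣ three?) ⟩
      sum cost + 4 * sum (⟦_⟧ ∘ three?)                    ≡⟨ cong (sum cost +_) (≡.sym (sum-*ˡ 4 (⟦_⟧ ∘ three?))) ⟩
      sum cost + sum (λ v → 4 * ⟦ three? v ⟧)              ≡⟨ ≡.sym (∑-distrib-+ cost (λ v → 4 * ⟦ three? v ⟧)) ⟩
      sum (λ v → cost v + 4 * ⟦ three? v ⟧)                ≡⟨ sum-cong-≗ pointwise ⟩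
      sum (λ v → deg v + 2 * 1)                            ≡⟨ ∑-distrib-+ deg (λ _ → 2 * 1) ⟩
      sum deg + sum {n} (λ _ → 2 * 1)                      ≡⟨ cong (sum deg +_) (trans (sum-*ˡ {n} 2 (λ _ → 1)) (cong (2 *_) (sum-one n))) ⟩
      sum deg + 2 * n                                      ∎
      where
      open ≡-Reasoning
      three? : Fin n → Bool
      three? v = degree G v ≡ᵇ 3
      -- At degree three this reads 1 + 4 = 3 + 2; elsewhere the cost is the degree plus 2.
      pointwise : ∀ v → cost v + 4 * ⟦ three? v ⟧ ≡ deg v + 2 * 1
      pointwise v rewrite degree≡deg G v with deg v ≤? 3
      ... | yes ≤3 rewrite ≤-antisym ≤3 (deg≥3 v) = refl
      ... | no ≰3 with deg v ≡ᵇ 3 in eq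
      ...   | false = +-identityʳ _
      ...   | true  = ⊥-elim (≰3 (≤-reflexive (≡ᵇ⇒≡ (deg v) 3 (subst T (≡.sym eq) _))))

    many-cubic : n + 3 ≤ 2 * v₃ G
    many-cubic with n + 3 ≤? 2 * v₃ G
    ... | yes p = p
    ... | no few = ⊥-elim (absorb v₀≤3 n (λ _ → 0) (m≤n+m n _) (λ v → δ≤1 v) start end)
      where
      v₀ : Fin n
      v₀ = proj₁ cubic-exists
      v₀≤3 : deg v₀ ≤ 3
      v₀≤3 = proj₂ cubic-exists
      δ≤1 : ∀ v → δ v₀ v ≤ 1
      δ≤1 v with v₀ ≟ v
      ... | yes _ = ≤-refl
      ... | no _  = z≤n
      start : total (λ _ → 0) ≤ e (λ _ → 0) (λ _ → 0)
      start = ≤-trans (≤-reflexive (sum-zero λ v → *-zeroʳ (cost v))) z≤n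
      end : ∀ M → (∀ v → M v + δ v₀ v ≡ 1) → ¬ total M ≤ e M M
      end M whole positive = <-irrefl refl (begin-strict
        4 * v₃ G                ≡⟨ *-assoc 2 2 (v₃ G) ⟩
        2 * (2 * v₃ G)          ≤⟨ *-monoʳ-≤ 2 (≤-pred (≤-trans (≰⇒> few) (≤-reflexive (+-suc n 2)))) ⟩
        -- Parity enters here: denying the bound leaves at most 2n + 4, so the surplus 5 already
        -- contradicts it.
        2 * (n + 2)             <⟨ n<1+n (2 * (n + 2)) ⟩
        suc (2 * (n + 2))       ≡⟨ solve 1 (λ k → con 1 :+ con 2 :* (k :+ con 2) := con 5 :+ con 2 :* k) refl n ⟩
        5 + 2 * n               ≤⟨ +-cancelˡ-≤ (sum cost) (5 + 2 * n) (4 * v₃ G) counted ⟩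
        4 * v₃ G                ∎)
        where
        open ≤-Reasoning
        dM dδ : ℕ
        dM = d M v₀
        dδ = d (δ v₀) v₀
        dδ≡0 : dδ ≡ 0
        dδ≡0 = trans (sum-cong-≗ λ w → *-comm ⟦ adj G v₀ w ⟧ (δ v₀ w))
                 (trans (sum-pick v₀ (λ w → ⟦ adj G v₀ w ⟧)) (cong ⟦_⟧ (irrefl G v₀)))
        deg≡d : ∀ u → deg u ≡ d (M ⊞ δ v₀) u
        deg≡d u = sum-cong-≗ λ w → ≡.sym (trans (cong (⟦ adj G u w ⟧ *_) (whole w)) (*-identityʳ _))
        3≤dM : 3 ≤ dM
        3≤dM = begin
          3                    ≤⟨ deg≥3 v₀ ⟩
          deg v₀               ≡⟨ trans (deg≡d v₀) (d-⊞ M (δ v₀) v₀) ⟩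
          dM + dδ              ≡⟨ trans (cong (dM +_) dδ≡0) (+-identityʳ dM) ⟩
          dM                   ∎
        sum-cost : sum cost ≡ total M + 1
        sum-cost = trans (sum-cong-≗ λ v → ≡.sym (trans (cong (cost v *_) (whole v)) (*-identityʳ (cost v))))
          (trans (total-⊞ M (δ v₀)) (cong (total M +_) (trans (total-δ v₀) (cost-cubic v₀≤3))))
        sum-deg : sum deg ≡ e M M + (2 * dM + dδ)
        sum-deg = trans (sum-cong-≗ λ u → trans (deg≡d u) (≡.sym (trans (cong (_* d (M ⊞ δ v₀) u) (whole u)) (*-identityˡ _))))
          (trans (e-square M (δ v₀)) (cong (e M M +_) (cong₂ (λ a b → 2 * a + b) (e-δ v₀ M) (e-δ v₀ (δ v₀)))))
        counted : sum cost + (5 + 2 * n) ≤ sum cost + 4 * v₃ G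
        counted = begin
          sum cost + (5 + 2 * n)                  ≡⟨ cong (_+ (5 + 2 * n)) sum-cost ⟩
          total M + 1 + (5 + 2 * n)               ≡⟨ solve 2 (λ t k → t :+ con 1 :+ (con 5 :+ k) := t :+ con 6 :+ k) refl (total M) (2 * n) ⟩
          -- The three edges at `v₀`, counted twice, supply the 6, of which 1 is the cost of `v₀`.
          total M + 6 + 2 * n                     ≤⟨ +-monoˡ-≤ (2 * n) (+-mono-≤ positive (≤-trans (*-monoʳ-≤ 2 3≤dM) (m≤m+n _ dδ))) ⟩
          e M M + (2 * dM + dδ) + 2 * n           ≡⟨ cong (_+ 2 * n) (≡.sym sum-deg) ⟩
          sum deg + 2 * n                         ≡⟨ ≡.sym v₃-count ⟩
          sum cost + 4 * v₃ G                     ∎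

theorem4p2 : ∀ {n : ℕ} (G : Graph n) → MinimallyThreeConnected G → CriticallyThreeConnected G →
    n + 3 ≤ 2 * v₃ G
theorem4p2 G minimal critical = Minimal.Critical.many-cubic G minimal critical
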